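{- In the OSW model described in the context, for $u\in V$ let $E_u$ be the event that $G_n$ contains a directed 3-cycle $u\to x\to y\to u$ (with $u,x,y$ distinct and each arc in $E$) at least one of whose arcs is a long-range edge, i.e., an arc $(p,q)$ with $\{p,q\}\notin E'$ (such an arc is present exactly when $p$ chooses $q$). Then $\Pr(E_u)=\mathcal{O}(\log^{ -1} n)$ as $n\to\infty$, uniformly in $u\in V$.
   Context: Let $n\ge1$ be an integer, $V=\{u\in\mathbb{Z}^3:\sum_{i=1}^3|u_i|=n\}$, $E'=\{\{v,w\}\subset V: v\ne w,\ |v_i-w_i|\le1\ \forall 1\le i\le3\}$ (the undirected $n$-octahedral graph $G'_n=(V,E')$), and let $d_{uv}$ be the shortest-path distance in $G'_n$. For $u\in V$ let $Z_u=\left(\sum_{w\in V\setminus\{u\}}d_{uw}^{ -2}\right)^{ -1}$. The OSW graph $G_n=(V,E)$ is the random directed graph whose edge set $E$ contains (i) both directed edges $(u,v)$ and $(v,u)$ for every $\{u,v\}\in E'$, and (ii) for each $u\in V$, independently, one directed edge $(u,v)$ where $v\in V\setminus\{u\}$ is chosen with probability $Z_u d_{uv}^{ -2}$. -}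

module Defs where

open import Data.Bool using (Bool; true; false; _∧_; _∨_; not; if_then_else_)
open import Data.Nat as ℕ using (ℕ; zero; suc)
open import Data.Integer as ℤ using (ℤ; +_; ∣_∣)
open import Data.Rational as ℚ using (ℚ; 0ℚ; 1ℚ)
import Data.Rational.Properties as ℚP
open import Data.Product using (_×_; _,_)
open import Data.List using (List; []; _∷_; [_]; map; concatMap; filter; length; upTo; foldr)
open import Data.Bool.ListAction using (any)
open import Data.Bool using (T?)
open import Relation.Nullary.Decidable using (⌊_⌋)
open import Relation.Nullary using (yes; no; ¬_)
open import Relation.Binary.PropositionalEquality using (_≡_)

Point : Set
Point = ℤ × ℤ × ℤ

_==_ : Point → Point → Bool
(a , b , c) == (a' , b' , c') = ⌊ a ℤ.≟ a' ⌋ ∧ ⌊ b ℤ.≟ b' ⌋ ∧ ⌊ c ℤ.≟ c' ⌋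

norm1 : Point → ℕ
norm1 (a , b , c) = ∣ a ∣ ℕ.+ ∣ b ∣ ℕ.+ ∣ c ∣

range : ℕ → List ℤ
range n = map (λ k → (+ k) ℤ.- (+ n)) (upTo (suc (2 ℕ.* n)))

verts : ℕ → List Point
verts n = filter (λ p → norm1 p ℕ.≟ n)
  (concatMap (λ a → concatMap (λ b → map (λ c → (a , b , c)) (range n)) (range n)) (range n))

adj : Point → Point → Bool
adj (a , b , c) (a' , b' , c') =
  not ((a , b , c) == (a' , b' , c'))
  ∧ ⌊ ∣ a ℤ.- a' ∣ ℕ.≤? 1 ⌋ ∧ ⌊ ∣ b ℤ.- b' ∣ ℕ.≤? 1 ⌋ ∧ ⌊ ∣ c ℤ.- c' ∣ ℕ.≤? 1 ⌋

reach : ℕ → ℕ → Point → Point → Bool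
reach n zero u w = u == w
reach n (suc k) u w = reach n k u w ∨ any (λ v → reach n k u v ∧ adj v w) (verts n)

distSearch : ℕ → Point → Point → ℕ → ℕ → ℕ
distSearch n u w zero k = k
distSearch n u w (suc f) k = if reach n k u w then k else distSearch n u w f (suc k)

-- shortest-path distance d_{uw} in G'_n (G'_n is connected, so its
-- diameter is < |V| and the search with fuel |V| finds the true distance)
dist : ℕ → Point → Point → ℕ
dist n u w = distSearch n u w (length (verts n)) 0

-- reciprocal in ℚ (total; 1/0 := 0, never used in the nondegenerate case)
recip : ℚ → ℚ
recip p with p ℚP.≟ 0ℚ
... | yes _ = 0ℚ
... | no p≢0 = ℚ.1/_ p {{ℚ.≢-nonZero p≢0}}

fromℕ : ℕ → ℚ
fromℕ k = (+ k) ℚ./ 1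

sumℚ : List ℚ → ℚ
sumℚ = foldr ℚ._+_ 0ℚ

prodℚ : List ℚ → ℚ
prodℚ = foldr ℚ._*_ 1ℚ

invSq : ℕ → ℚ
invSq d = recip (fromℕ (d ℕ.* d))

others : ℕ → Point → List Point
others n u = filter (λ w → T? (not (u == w))) (verts n)

Z : ℕ → Point → ℚ
Z n u = recip (sumℚ (map (λ w → invSq (dist n u w)) (others n u)))

choiceProb : ℕ → Point → Point → ℚ
choiceProb n u v = Z n u ℚ.* invSq (dist n u v)

-- An outcome of the randomness: a list of pairs (v , choice of v),
-- one for each vertex v ∈ V.
Outcome : Set
Outcome = List (Point × Point)

outcomesFor : ℕ → List Point → List Outcome
outcomesFor n [] = [ [] ]
outcomesFor n (v ∷ vs) =
  concatMap (λ rest → map (λ c → (v , c) ∷ rest) (others n v)) (outcomesFor n vs)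

outcomes : ℕ → List Outcome
outcomes n = outcomesFor n (verts n)

weight : ℕ → Outcome → ℚ
weight n o = prodℚ (map (λ { (v , c) → choiceProb n v c }) o)

chose : Outcome → Point → Point → Bool
chose o p q = any (λ { (v , c) → (v == p) ∧ (c == q) }) o

arc : Outcome → Point → Point → Bool
arc o p q = adj p q ∨ chose o p q

longArc : Outcome → Point → Point → Bool
longArc o p q = not (adj p q) ∧ chose o p q

eventE : ℕ → Point → Outcome → Bool
eventE n u o = any (λ x → any (λ y →
     not (u == x) ∧ not (u == y) ∧ not (x == y)
   ∧ arc o u x ∧ arc o x y ∧ arc o y u
   ∧ (longArc o u x ∨ longArc o x y ∨ longArc o y u)) (verts n)) (verts n)

PrE : ℕ → Point → ℚ
PrE n u = sumℚ (map (λ o → if eventE n u o then weight n o else 0ℚ) (outcomes n))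

{-# OPTIONS --safe #-}

-- Every vertex v has normaliser Z_v = O(1/log n): if v = (a, b, c) with |c| ≥ n/3, moving i + j = k ≤ |c| units
-- of absolute value from c to a and b is a walk of k steps, so at least k vertices lie within distance k, and the
-- sum defining 1/Z_v dominates the harmonic sum up to n/3. Hence any prescribed choice has probability at most
-- ζ = O(1/log n).
-- In a triangle u → x → y → u with a long arc, look at the last arc that is not an edge of G'ₙ. It costs a
-- factor ζ, the arcs after it are edges, and the arcs before it are edges or choices. Since the out-choices of
-- a vertex have total probability at most 1 and the degrees are at most 27, summing over x and y costs at most
-- 28 · 28 in each of the three cases.
module Submission where

open import Defs
open import Data.Nat using (ℕ; _≤_)
open import Data.Nat.Logarithm using (⌊log₂_⌋)
open import Data.Rational using (ℚ) renaming (_≤_ to _≤ℚ_; _*_ to _*ℚ_)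
open import Data.Product using (∃-syntax)
open import Relation.Binary.PropositionalEquality using (_≡_)

open import Algebra.Bundles using (AbelianGroup; CommutativeMonoid)
import Algebra.Properties.CommutativeSemigroup as CommutativeSemigroup
import Algebra.Properties.Group as Group
open import Data.Bool using (Bool; true; false; _∧_; _∨_; not; if_then_else_; T; T?)
open import Data.Bool.Properties using (T-∧; T-∨; T-≡; T-not-≡)
open import Data.Empty using (⊥-elim)
open import Data.Integer as ℤ using (ℤ; ∣_∣; sign; _◃_)
import Data.Integer.Properties as ℤP
open import Data.List using (List; []; _∷_; [_]; map; concatMap; filter; length; upTo; _++_; cartesianProduct)
open import Data.List.Membership.Propositional using (_∈_; find; lose)
open import Data.List.Membership.Propositional.Properties
open import Data.List.Properties using (map-∘; map-cong; map-concatMap; concatMap-cong; length-map; length-upTo)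
open import Data.List.Relation.Binary.Permutation.Propositional using (_↭_; ↭-refl; ↭-trans; ↭-sym; prep; ↭⇒↭ₛ)
open import Data.List.Relation.Binary.Permutation.Propositional.Properties using (shift; ∈-resp-↭; map⁺)
import Data.List.Relation.Binary.Permutation.Setoid.Properties as ↭ₛ
open import Data.List.Relation.Binary.Subset.Propositional using (_⊆_)
open import Data.List.Relation.Unary.All as All using ([]; _∷_)
open import Data.List.Relation.Unary.AllPairs using ([]; _∷_)
open import Data.List.Relation.Unary.Any using (here; there)
open import Data.List.Relation.Unary.Any.Properties using (any⁻; any⁺)
open import Data.List.Relation.Unary.Unique.Propositional using (Unique)
import Data.List.Relation.Unary.Unique.Propositional.Properties as Unique
open import Data.Nat as ℕ using (zero; suc)
open import Data.Nat.Logarithm using (⌊log₂⌋-mono-≤; ⌊log₂[2^n]⌋≡n)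
import Data.Nat.Properties as ℕP
open import Data.Product using (_×_; _,_; proj₁; proj₂; ∃)
open import Data.Rational as ℚ using (0ℚ; 1ℚ; _+_; 1/_; Positive)
open import Data.Rational.Properties hiding (_≟_)
import Data.Rational.Unnormalised as ℚᵘ
import Data.Rational.Unnormalised.Properties as ℚᵘP
open import Data.Sign as Sign using (Sign)
open import Data.Sum using (_⊎_; inj₁; inj₂)
open import Data.Unit using (tt)
open import Function using (_∘_; id; Equivalence)
open import Relation.Binary.PropositionalEquality
  using (_≢_; refl; sym; trans; cong; cong₂; subst; setoid; module ≡-Reasoning)
open import Relation.Nullary using (yes; no; ¬_; contradiction)
open import Relation.Nullary.Decidable using (⌊_⌋; toWitness; fromWitness)

open Equivalence using (to; from)

-- The split by the last long arc is dictated by the summation over `x` and `y`. Normalisation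
-- bounds the total probability of the choices leaving a vertex, but gives no direct bound for those
-- entering it, because each chooser has its own normaliser; edges of G'ₙ can be summed in both
-- directions. So arcs before the long one are summed forwards from `u`, arcs after it backwards
-- from `u`, and the long arc itself is estimated pointwise and never summed over. Independence is
-- used for one kind of event only, a condition on the choices of three distinct vertices, encoded
-- as a product over all vertices. Distances are never computed: explicit walks bound them from
-- above.

private
  module ℤG = Group (AbelianGroup.group ℤP.+-0-abelianGroup)
  module ℕ+ = CommutativeSemigroup ℕP.+-commutativeSemigroup
  module ℚ+ = CommutativeSemigroup (CommutativeMonoid.commutativeSemigroup +-0-commutativeMonoid)
  variable
    A B : Set

-- Finite sums and products of rationals

Σℚ : List A → (A → ℚ) → ℚ
Σℚ xs f = sumℚ (map f xs)

Πℚ : List A → (A → ℚ) → ℚ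
Πℚ xs f = prodℚ (map f xs)

*-mono-≤ : ∀ {p q r s} → 0ℚ ≤ℚ p → p ≤ℚ q → 0ℚ ≤ℚ r → r ≤ℚ s → p *ℚ r ≤ℚ q *ℚ s
*-mono-≤ {p} {q} {r} {s} 0≤p p≤q 0≤r r≤s =
  ≤-trans (*-monoʳ-≤-nonNeg r {{ℚ.nonNegative 0≤r}} p≤q)
          (*-monoˡ-≤-nonNeg q {{ℚ.nonNegative (≤-trans 0≤p p≤q)}} r≤s)

*-nonneg : ∀ {p q} → 0ℚ ≤ℚ p → 0ℚ ≤ℚ q → 0ℚ ≤ℚ p *ℚ q
*-nonneg {p} {q} 0≤p 0≤q = subst (_≤ℚ p *ℚ q) (*-zeroˡ 0ℚ) (*-mono-≤ ≤-refl 0≤p ≤-refl 0≤q)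

+-nonneg : ∀ {p q} → 0ℚ ≤ℚ p → 0ℚ ≤ℚ q → 0ℚ ≤ℚ p + q
+-nonneg 0≤p 0≤q = +-mono-≤ 0≤p 0≤q

p≤p+q : ∀ {p q} → 0ℚ ≤ℚ q → p ≤ℚ p + q
p≤p+q {p} {q} 0≤q = subst (_≤ℚ p + q) (+-identityʳ p) (+-monoʳ-≤ p 0≤q)

p≤q+p : ∀ {p q} → 0ℚ ≤ℚ q → p ≤ℚ q + p
p≤q+p {p} {q} 0≤q = subst (p ≤ℚ_) (+-comm p q) (p≤p+q 0≤q)

0≤1 : 0ℚ ≤ℚ 1ℚ
0≤1 = nonNegative⁻¹ 1ℚ

Σ-mono : ∀ (xs : List A) {f g} → (∀ {x} → x ∈ xs → f x ≤ℚ g x) → Σℚ xs f ≤ℚ Σℚ xs g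
Σ-mono []       f≤g = ≤-refl
Σ-mono (x ∷ xs) f≤g = +-mono-≤ (f≤g (here refl)) (Σ-mono xs (f≤g ∘ there))

Σ-nonneg : ∀ (xs : List A) {f} → (∀ {x} → x ∈ xs → 0ℚ ≤ℚ f x) → 0ℚ ≤ℚ Σℚ xs f
Σ-nonneg []       0≤f = ≤-refl
Σ-nonneg (x ∷ xs) 0≤f = +-nonneg (0≤f (here refl)) (Σ-nonneg xs (0≤f ∘ there))

Σ-zero : ∀ (xs : List A) → Σℚ xs (λ _ → 0ℚ) ≡ 0ℚ
Σ-zero []       = refl
Σ-zero (x ∷ xs) = trans (+-identityˡ _) (Σ-zero xs)

Σ-+ : ∀ (xs : List A) f g → Σℚ xs (λ x → f x + g x) ≡ Σℚ xs f + Σℚ xs g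
Σ-+ []       f g = refl
Σ-+ (x ∷ xs) f g = trans (cong (f x + g x +_) (Σ-+ xs f g)) (ℚ+.interchange (f x) (g x) _ _)

Σ-*ˡ : ∀ (xs : List A) p f → Σℚ xs (λ x → p *ℚ f x) ≡ p *ℚ Σℚ xs f
Σ-*ˡ []       p f = sym (*-zeroʳ p)
Σ-*ˡ (x ∷ xs) p f = trans (cong (p *ℚ f x +_) (Σ-*ˡ xs p f)) (sym (*-distribˡ-+ p (f x) _))

Σ-*ʳ : ∀ (xs : List A) f p → Σℚ xs (λ x → f x *ℚ p) ≡ Σℚ xs f *ℚ p
Σ-*ʳ []       f p = sym (*-zeroˡ p)
Σ-*ʳ (x ∷ xs) f p = trans (cong (f x *ℚ p +_) (Σ-*ʳ xs f p)) (sym (*-distribʳ-+ p (f x) _))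

Σ-swap : ∀ (xs : List A) (ys : List B) (f : A → B → ℚ) →
         Σℚ xs (λ x → Σℚ ys (λ y → f x y)) ≡ Σℚ ys (λ y → Σℚ xs (λ x → f x y))
Σ-swap []       ys f = sym (Σ-zero ys)
Σ-swap (x ∷ xs) ys f =
  trans (cong (Σℚ ys (f x) +_) (Σ-swap xs ys f)) (sym (Σ-+ ys (f x) (λ y → Σℚ xs (λ x → f x y))))

Σ-++ : ∀ (xs ys : List A) f → Σℚ (xs ++ ys) f ≡ Σℚ xs f + Σℚ ys f
Σ-++ []       ys f = sym (+-identityˡ _)
Σ-++ (x ∷ xs) ys f = trans (cong (f x +_) (Σ-++ xs ys f)) (sym (+-assoc (f x) _ _))

Σ-map : ∀ (xs : List A) (g : A → B) f → Σℚ (map g xs) f ≡ Σℚ xs (f ∘ g)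
Σ-map []       g f = refl
Σ-map (x ∷ xs) g f = cong (f (g x) +_) (Σ-map xs g f)

Σ-concatMap : ∀ (xs : List A) (g : A → List B) f →
              Σℚ (concatMap g xs) f ≡ Σℚ xs (λ x → Σℚ (g x) f)
Σ-concatMap []       g f = refl
Σ-concatMap (x ∷ xs) g f =
  trans (Σ-++ (g x) _ f) (cong (Σℚ (g x) f +_) (Σ-concatMap xs g f))

Σ-cong : ∀ (xs : List A) {f g} → (∀ x → f x ≡ g x) → Σℚ xs f ≡ Σℚ xs g
Σ-cong xs f≡g = cong sumℚ (map-cong f≡g xs)

x≤Σ : ∀ {xs : List A} {f x} → (∀ {y} → y ∈ xs → 0ℚ ≤ℚ f y) → x ∈ xs → f x ≤ℚ Σℚ xs f
x≤Σ {xs = _ ∷ xs} 0≤f (here refl) = p≤p+q (Σ-nonneg xs (0≤f ∘ there))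
x≤Σ 0≤f (there x∈xs) = ≤-trans (x≤Σ (0≤f ∘ there) x∈xs) (p≤q+p (0≤f (here refl)))

Π-nonneg : ∀ (xs : List A) {f} → (∀ x → 0ℚ ≤ℚ f x) → 0ℚ ≤ℚ Πℚ xs f
Π-nonneg []       0≤f = 0≤1
Π-nonneg (x ∷ xs) 0≤f = *-nonneg (0≤f x) (Π-nonneg xs 0≤f)

Π≤1 : ∀ (xs : List A) {f} → (∀ {x} → x ∈ xs → 0ℚ ≤ℚ f x × f x ≤ℚ 1ℚ) → 0ℚ ≤ℚ Πℚ xs f × Πℚ xs f ≤ℚ 1ℚ
Π≤1 []       h = 0≤1 , ≤-refl
Π≤1 (x ∷ xs) {f} h =
  let 0≤fx , fx≤1 = h (here refl) ; 0≤Π , Π≤ = Π≤1 xs (h ∘ there) in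
  *-nonneg 0≤fx 0≤Π , subst (f x *ℚ Πℚ xs f ≤ℚ_) (*-identityˡ 1ℚ) (*-mono-≤ 0≤fx fx≤1 0≤Π Π≤)

-- The leftover entries become an explicit list `zs`, so comparing sums or products over `xs` and
-- `ys` reduces to discarding the part over `zs`.
unique-⊆⇒↭ : ∀ {xs ys : List A} → Unique xs → xs ⊆ ys → ∃ λ zs → ys ↭ xs ++ zs
unique-⊆⇒↭ {xs = []}     {ys} _ _ = ys , ↭-refl
unique-⊆⇒↭ {xs = x ∷ xs} {ys} (x∉xs ∷ xs!) xs⊆ys
  with l , r , refl ← ∈-∃++ (xs⊆ys (here refl))
  = let zs , σ = unique-⊆⇒↭ xs! tail⊆ in zs , ↭-trans (shift x l r) (prep x σ)
  where
  tail⊆ : xs ⊆ l ++ r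
  tail⊆ {y} y∈xs with ∈-resp-↭ (shift x l r) (xs⊆ys (there y∈xs))
  ... | here y≡x  = contradiction (sym y≡x) (All.lookup x∉xs y∈xs)
  ... | there y∈  = y∈

Σ-↭ : ∀ {xs ys : List A} f → xs ↭ ys → Σℚ xs f ≡ Σℚ ys f
Σ-↭ f σ = ↭ₛ.foldr-commMonoid (setoid ℚ) +-0-isCommutativeMonoid (↭⇒↭ₛ (map⁺ f σ))

Π-↭ : ∀ {xs ys : List A} f → xs ↭ ys → Πℚ xs f ≡ Πℚ ys f
Π-↭ f σ = ↭ₛ.foldr-commMonoid (setoid ℚ) *-1-isCommutativeMonoid (↭⇒↭ₛ (map⁺ f σ))

Σ-⊆ : ∀ {xs ys : List A} {f} → Unique xs → xs ⊆ ys → (∀ {y} → y ∈ ys → 0ℚ ≤ℚ f y) →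
      Σℚ xs f ≤ℚ Σℚ ys f
Σ-⊆ {xs = xs} {ys} {f} xs! xs⊆ys 0≤f =
  let zs , σ = unique-⊆⇒↭ xs! xs⊆ys in
  subst (Σℚ xs f ≤ℚ_) (sym (trans (Σ-↭ f σ) (Σ-++ xs zs f)))
    (p≤p+q (Σ-nonneg zs (λ z∈ → 0≤f (∈-resp-↭ (↭-sym σ) (∈-++⁺ʳ xs z∈)))))

Π-++ : ∀ (xs ys : List A) f → Πℚ (xs ++ ys) f ≡ Πℚ xs f *ℚ Πℚ ys f
Π-++ []       ys f = sym (*-identityˡ _)
Π-++ (x ∷ xs) ys f = trans (cong (f x *ℚ_) (Π-++ xs ys f)) (sym (*-assoc (f x) _ _))

-- Applied with `xs` the vertices of a triangle and `ys` all vertices: the choices of the other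
-- vertices contribute factors of at most 1.
Π-⊆ : ∀ {xs ys : List A} {f} → Unique xs → xs ⊆ ys →
      (∀ {y} → y ∈ ys → 0ℚ ≤ℚ f y × f y ≤ℚ 1ℚ) → Πℚ ys f ≤ℚ Πℚ xs f
Π-⊆ {xs = xs} {ys} {f} xs! xs⊆ys f∈[0,1] =
  let zs , σ = unique-⊆⇒↭ xs! xs⊆ys
      0≤z , z≤1 = Π≤1 zs (λ z∈ → f∈[0,1] (∈-resp-↭ (↭-sym σ) (∈-++⁺ʳ xs z∈)))
      0≤x , _   = Π≤1 xs (f∈[0,1] ∘ xs⊆ys)
  in subst (_≤ℚ Πℚ xs f) (sym (trans (Π-↭ f σ) (Π-++ xs zs f)))
       (subst (Πℚ xs f *ℚ Πℚ zs f ≤ℚ_) (*-identityʳ _) (*-mono-≤ 0≤x ≤-refl 0≤z z≤1))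

-- Indicators, naturals as rationals, and reciprocals

⟦_⟧ : Bool → ℚ
⟦ b ⟧ = if b then 1ℚ else 0ℚ

0≤⟦⟧ : ∀ b → 0ℚ ≤ℚ ⟦ b ⟧
0≤⟦⟧ true  = 0≤1
0≤⟦⟧ false = ≤-refl

⟦⟧≤1 : ∀ b → ⟦ b ⟧ ≤ℚ 1ℚ
⟦⟧≤1 true  = ≤-refl
⟦⟧≤1 false = 0≤1

-- Division in ℚ normalises by a gcd, so the identity is checked on unnormalised fractions, where
-- all denominators are 1.
fromℕ-+ : ∀ m n → fromℕ (m ℕ.+ n) ≡ fromℕ m + fromℕ n
fromℕ-+ m n = toℚᵘ-injective (begin
  ℚ.toℚᵘ (fromℕ (m ℕ.+ n))            ≈⟨ toℚᵘ-fromℚᵘ (ℚᵘ.mkℚᵘ (ℤ.+ (m ℕ.+ n)) 0) ⟩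
  ℚᵘ.mkℚᵘ (ℤ.+ (m ℕ.+ n)) 0             ≈⟨ ℚᵘ.*≡* (cong (ℤ._* ℤ.+ 1) (trans (ℤP.pos-+ m n) (sym (cong₂ ℤ._+_ (ℤP.*-identityʳ (ℤ.+ m)) (ℤP.*-identityʳ (ℤ.+ n)))))) ⟩
  ℚᵘ.mkℚᵘ (ℤ.+ m) 0 ℚᵘ.+ ℚᵘ.mkℚᵘ (ℤ.+ n) 0 ≈⟨ ℚᵘP.≃-sym (ℚᵘP.+-cong (toℚᵘ-fromℚᵘ (ℚᵘ.mkℚᵘ (ℤ.+ m) 0)) (toℚᵘ-fromℚᵘ (ℚᵘ.mkℚᵘ (ℤ.+ n) 0))) ⟩
  ℚ.toℚᵘ (fromℕ m) ℚᵘ.+ ℚ.toℚᵘ (fromℕ n) ≈⟨ ℚᵘP.≃-sym (toℚᵘ-homo-+ (fromℕ m) (fromℕ n)) ⟩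
  ℚ.toℚᵘ (fromℕ m + fromℕ n) ∎)
  where open ℚᵘP.≃-Reasoning

0≤fromℕ : ∀ n → 0ℚ ≤ℚ fromℕ n
0≤fromℕ zero    = ≤-refl
0≤fromℕ (suc n) = subst (0ℚ ≤ℚ_) (sym (fromℕ-+ 1 n)) (+-nonneg 0≤1 (0≤fromℕ n))

fromℕ-mono : ∀ {m n} → m ℕ.≤ n → fromℕ m ≤ℚ fromℕ n
fromℕ-mono {m} {n} m≤n =
  subst (fromℕ m ≤ℚ_) (trans (sym (fromℕ-+ m (n ℕ.∸ m))) (cong fromℕ (ℕP.m+[n∸m]≡n m≤n)))
    (p≤p+q (0≤fromℕ (n ℕ.∸ m)))

fromℕ-* : ∀ m n → fromℕ (m ℕ.* n) ≡ fromℕ m *ℚ fromℕ n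
fromℕ-* zero    n = sym (*-zeroˡ (fromℕ n))
fromℕ-* (suc m) n = begin
  fromℕ (n ℕ.+ m ℕ.* n)             ≡⟨ fromℕ-+ n (m ℕ.* n) ⟩
  fromℕ n + fromℕ (m ℕ.* n)         ≡⟨ cong₂ _+_ (sym (*-identityˡ (fromℕ n))) (fromℕ-* m n) ⟩
  1ℚ *ℚ fromℕ n + fromℕ m *ℚ fromℕ n  ≡⟨ sym (*-distribʳ-+ (fromℕ n) 1ℚ (fromℕ m)) ⟩
  (1ℚ + fromℕ m) *ℚ fromℕ n          ≡⟨ cong (_*ℚ fromℕ n) (sym (fromℕ-+ 1 m)) ⟩
  fromℕ (suc m) *ℚ fromℕ n           ∎
  where open ≡-Reasoning

0<fromℕ-suc : ∀ n → 0ℚ ℚ.< fromℕ (suc n)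
0<fromℕ-suc n = <-≤-trans (positive⁻¹ 1ℚ) (subst (1ℚ ≤ℚ_) (sym (fromℕ-+ 1 n)) (p≤p+q (0≤fromℕ n)))

Σ-const : ∀ (xs : List A) p → Σℚ xs (λ _ → p) ≡ fromℕ (length xs) *ℚ p
Σ-const []       p = sym (*-zeroˡ p)
Σ-const (x ∷ xs) p = begin
  p + Σℚ xs (λ _ → p)              ≡⟨ cong₂ _+_ (sym (*-identityˡ p)) (Σ-const xs p) ⟩
  1ℚ *ℚ p + fromℕ (length xs) *ℚ p   ≡⟨ sym (*-distribʳ-+ p 1ℚ (fromℕ (length xs))) ⟩
  (1ℚ + fromℕ (length xs)) *ℚ p     ≡⟨ cong (_*ℚ p) (sym (fromℕ-+ 1 (length xs))) ⟩
  fromℕ (suc (length xs)) *ℚ p      ∎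
  where open ≡-Reasoning

recip-inverse : ∀ {p} → 0ℚ ℚ.< p → p *ℚ recip p ≡ 1ℚ
recip-inverse {p} 0<p with p ℚ.≟ 0ℚ
... | yes refl = contradiction 0<p (<-irrefl refl)
... | no p≢0   = *-inverseʳ p {{ℚ.≢-nonZero p≢0}}

recip-nonneg : ∀ {p} → 0ℚ ≤ℚ p → 0ℚ ≤ℚ recip p
recip-nonneg {p} 0≤p with p ℚ.≟ 0ℚ
... | yes refl = ≤-refl
... | no p≢0   = nonNegative⁻¹ 1/p {{pos⇒nonNeg 1/p {{1/pos⇒pos p {{p⁺}}}}}}
  where
  1/p = (1/ p) {{ℚ.≢-nonZero p≢0}}
  p⁺ : Positive p
  p⁺ = nonNeg∧nonZero⇒pos p {{ℚ.nonNegative 0≤p}} {{ℚ.≢-nonZero p≢0}}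

-- Also holds at the junk value p = 0.
recip*p≤1 : ∀ p → recip p *ℚ p ≤ℚ 1ℚ
recip*p≤1 p with p ℚ.≟ 0ℚ
... | yes refl = 0≤1
... | no p≢0   = ≤-reflexive (*-inverseˡ p {{ℚ.≢-nonZero p≢0}})

recip-antimono : ∀ {p q} → 0ℚ ℚ.< p → p ≤ℚ q → recip q ≤ℚ recip p
recip-antimono {p} {q} 0<p p≤q = begin
  recip q                 ≡⟨ sym (*-identityˡ _) ⟩
  1ℚ *ℚ recip q            ≡⟨ cong (_*ℚ recip q) (sym (recip-inverse 0<p)) ⟩
  p *ℚ recip p *ℚ recip q   ≤⟨ *-mono-≤ (*-nonneg 0≤p 0≤1/p) (*-mono-≤ 0≤p p≤q 0≤1/p ≤-refl) (recip-nonneg (≤-trans 0≤p p≤q)) ≤-refl ⟩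
  q *ℚ recip p *ℚ recip q   ≡⟨ cong (_*ℚ recip q) (*-comm q (recip p)) ⟩
  recip p *ℚ q *ℚ recip q   ≡⟨ *-assoc (recip p) q (recip q) ⟩
  recip p *ℚ (q *ℚ recip q) ≡⟨ cong (recip p *ℚ_) (recip-inverse (<-≤-trans 0<p p≤q)) ⟩
  recip p *ℚ 1ℚ            ≡⟨ *-identityʳ _ ⟩
  recip p                 ∎
  where
  open ≤-Reasoning
  0≤p = <⇒≤ 0<p
  0≤1/p = recip-nonneg 0≤p

-- The octahedral graph

==⇒≡ : ∀ p q → T (p == q) → p ≡ q
==⇒≡ (a , b , c) (a' , b' , c') t =
  let t₁ , t₂₃ = to (T-∧ {⌊ a ℤ.≟ a' ⌋}) t
      t₂ , t₃  = to (T-∧ {⌊ b ℤ.≟ b' ⌋}) t₂₃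
  in cong₂ _,_ (toWitness {a? = a ℤ.≟ a'} t₁)
       (cong₂ _,_ (toWitness {a? = b ℤ.≟ b'} t₂) (toWitness {a? = c ℤ.≟ c'} t₃))

==-refl : ∀ p → T (p == p)
==-refl (a , b , c) =
  from T-∧ (fromWitness {a? = a ℤ.≟ a} refl ,
  from T-∧ (fromWitness {a? = b ℤ.≟ b} refl , fromWitness {a? = c ℤ.≟ c} refl))

not-==⇒≢ : ∀ p q → T (not (p == q)) → p ≢ q
not-==⇒≢ p .p t refl = subst T (to T-not-≡ t) (==-refl p)

≢⇒not-== : ∀ p q → p ≢ q → T (not (p == q))
≢⇒not-== p q p≢q with p == q in eq
... | true  = p≢q (==⇒≡ p q (from T-≡ eq))
... | false = tt

range-unique : ∀ n → Unique (range n)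
range-unique n =
  Unique.map⁺ (λ {i} {j} eq → ℤP.+-injective (ℤG.∙-cancelʳ (ℤ.- ℤ.+ n) (ℤ.+ i) (ℤ.+ j) eq)) (Unique.upTo⁺ _)

cube : ℕ → List Point
cube n = concatMap (λ a → concatMap (λ b → map (λ c → (a , b , c)) (range n)) (range n)) (range n)

cartesianProduct≡ : ∀ {A B : Set} (xs : List A) (ys : List B) →
  concatMap (λ x → map (x ,_) ys) xs ≡ cartesianProduct xs ys
cartesianProduct≡ []       ys = refl
cartesianProduct≡ (x ∷ xs) ys = cong (map (x ,_) ys ++_) (cartesianProduct≡ xs ys)

-- Uniqueness and membership in the nested enumeration then follow from those of cartesian products.
cube≡ : ∀ n → cube n ≡ cartesianProduct (range n) (cartesianProduct (range n) (range n))
cube≡ n = trans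
  (concatMap-cong (λ a → trans
     (concatMap-cong (λ b → map-∘ (range n)) (range n))
     (trans (sym (map-concatMap (a ,_) (λ b → map (b ,_) (range n)) (range n)))
            (cong (map (a ,_)) (cartesianProduct≡ (range n) (range n))))) (range n))
  (cartesianProduct≡ (range n) _)

verts-unique : ∀ n → Unique (verts n)
verts-unique n = Unique.filter⁺ (λ p → norm1 p ℕ.≟ n) (subst Unique (sym (cube≡ n))
  (Unique.cartesianProduct⁺ (range-unique n)
    (Unique.cartesianProduct⁺ (range-unique n) (range-unique n))))

∈-range : ∀ n z → ∣ z ∣ ℕ.≤ n → z ∈ range n
∈-range n z ∣z∣≤n = subst (_∈ range n) eq (∈-map⁺ _ (∈-upTo⁺ (ℕ.s≤s k≤2n)))
  where
  open ≡-Reasoning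
  0≤z+n : ℤ.+ 0 ℤ.≤ z ℤ.+ ℤ.+ n
  0≤z+n = subst (ℤ._≤ z ℤ.+ ℤ.+ n) (ℤP.+-inverseʳ z)
    (ℤP.+-monoʳ-≤ z (ℤP.≤-trans (-z≤∣z∣ z) (ℤ.+≤+ ∣z∣≤n)))
    where
    -z≤∣z∣ : ∀ z → ℤ.- z ℤ.≤ ℤ.+ ∣ z ∣
    -z≤∣z∣ (ℤ.+ zero)    = ℤP.≤-refl
    -z≤∣z∣ (ℤ.+ suc k)   = ℤ.-≤+
    -z≤∣z∣ (ℤ.-[1+ k ])  = ℤP.≤-refl
  -- The index of `z` in `range n`; the absolute value is harmless because `z + n` is nonnegative.
  k = ∣ z ℤ.+ ℤ.+ n ∣
  k≤2n : k ℕ.≤ 2 ℕ.* n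
  k≤2n = ℕP.≤-trans (ℤP.∣i+j∣≤∣i∣+∣j∣ z (ℤ.+ n))
    (ℕP.+-mono-≤ ∣z∣≤n (ℕP.≤-reflexive (sym (ℕP.+-identityʳ n))))
  eq : ℤ.+ k ℤ.- ℤ.+ n ≡ z
  eq = begin
    ℤ.+ k ℤ.- ℤ.+ n                 ≡⟨ cong (ℤ._- ℤ.+ n) (ℤP.0≤i⇒+∣i∣≡i 0≤z+n) ⟩
    (z ℤ.+ ℤ.+ n) ℤ.- ℤ.+ n         ≡⟨ ℤG.//-rightDividesʳ (ℤ.+ n) z ⟩
    z                               ∎

∈-verts : ∀ {n} u → norm1 u ≡ n → u ∈ verts n
∈-verts {n} (a , b , c) refl = ∈-filter⁺ (λ p → norm1 p ℕ.≟ n) (subst ((a , b , c) ∈_) (sym (cube≡ n))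
  (∈-cartesianProduct⁺ (∈-range n a (ℕP.≤-trans (ℕP.m≤m+n _ _) (ℕP.m≤m+n _ ∣ c ∣)))
    (∈-cartesianProduct⁺ (∈-range n b (ℕP.≤-trans (ℕP.m≤n+m _ ∣ a ∣) (ℕP.m≤m+n _ ∣ c ∣)))
      (∈-range n c (ℕP.m≤n+m _ _))))) refl

others-unique : ∀ n u → Unique (others n u)
others-unique n u = Unique.filter⁺ (λ w → T? (not (u == w))) (verts-unique n)

Σ-filter : ∀ (Q : A → Bool) xs → Σℚ xs (⟦_⟧ ∘ Q) ≡ Σℚ (filter (T? ∘ Q) xs) (λ _ → 1ℚ)
Σ-filter Q []       = refl
Σ-filter Q (x ∷ xs) with Q x
... | true  = cong (1ℚ +_) (Σ-filter Q xs)
... | false = trans (+-identityˡ _) (Σ-filter Q xs)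

-- The entries satisfying `Q` form a duplicate-free list inside `ys`. With `ys` a neighbourhood this
-- gives the degree bounds, with `ys` a singleton the fact that a choice hits a given target at most
-- once.
count≤length : ∀ (Q : A → Bool) {xs ys} → Unique xs → (∀ {x} → T (Q x) → x ∈ ys) →
               Σℚ xs (⟦_⟧ ∘ Q) ≤ℚ fromℕ (length ys)
count≤length Q {xs} {ys} xs! Q⊆ys = begin
  Σℚ xs (⟦_⟧ ∘ Q)                     ≡⟨ Σ-filter Q xs ⟩
  Σℚ (filter (T? ∘ Q) xs) (λ _ → 1ℚ)  ≤⟨ Σ-⊆ (Unique.filter⁺ (T? ∘ Q) xs!) (λ x∈ → Q⊆ys (proj₂ (∈-filter⁻ (T? ∘ Q) {xs = xs} x∈))) (λ _ → 0≤1) ⟩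
  Σℚ ys (λ _ → 1ℚ)                    ≡⟨ trans (Σ-const ys 1ℚ) (*-identityʳ _) ⟩
  fromℕ (length ys)                   ∎
  where open ≤-Reasoning

count-==≤1 : ∀ b {xs} → Unique xs → Σℚ xs (λ c → ⟦ c == b ⟧) ≤ℚ 1ℚ
count-==≤1 b xs! = count≤length (_== b) {ys = [ b ]} xs! (λ {x} t → here (==⇒≡ x b t))

Close : Point → Point → Set
Close (a , b , c) (a' , b' , c') = ∣ a ℤ.- a' ∣ ℕ.≤ 1 × ∣ b ℤ.- b' ∣ ℕ.≤ 1 × ∣ c ℤ.- c' ∣ ℕ.≤ 1

adj⇒Close : ∀ p q → T (adj p q) → Close p q
adj⇒Close (a , b , c) (a' , b' , c') t =
  let _  , t₁₂₃ = to (T-∧ {not ((a , b , c) == (a' , b' , c'))}) t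
      t₁ , t₂₃  = to (T-∧ {⌊ ∣ a ℤ.- a' ∣ ℕ.≤? 1 ⌋}) t₁₂₃
      t₂ , t₃   = to (T-∧ {⌊ ∣ b ℤ.- b' ∣ ℕ.≤? 1 ⌋}) t₂₃
  in toWitness {a? = ∣ a ℤ.- a' ∣ ℕ.≤? 1} t₁ ,
     toWitness {a? = ∣ b ℤ.- b' ∣ ℕ.≤? 1} t₂ ,
     toWitness {a? = ∣ c ℤ.- c' ∣ ℕ.≤? 1} t₃

Close⇒adj : ∀ p q → p ≢ q → Close p q → T (adj p q)
Close⇒adj p@(a , b , c) q@(a' , b' , c') p≢q (h₁ , h₂ , h₃) =
  from T-∧ (≢⇒not-== p q p≢q ,
  from T-∧ (fromWitness {a? = ∣ a ℤ.- a' ∣ ℕ.≤? 1} h₁ ,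
  from T-∧ (fromWitness {a? = ∣ b ℤ.- b' ∣ ℕ.≤? 1} h₂ , fromWitness {a? = ∣ c ℤ.- c' ∣ ℕ.≤? 1} h₃)))

Close-sym : ∀ p q → Close p q → Close q p
Close-sym (a , b , c) (a' , b' , c') (h₁ , h₂ , h₃) = flip a a' h₁ , flip b b' h₂ , flip c c' h₃
  where
  flip : ∀ i j → ∣ i ℤ.- j ∣ ℕ.≤ 1 → ∣ j ℤ.- i ∣ ℕ.≤ 1
  flip i j = subst (ℕ._≤ 1) (ℤP.∣i-j∣≡∣j-i∣ i j)

-- Written as `a - d` with `d` one of 0, 1, -1, so that membership of `b` is a case split on
-- `d = a - b`.
near : ℤ → List ℤ
near a = (a ℤ.- ℤ.+ 0) ∷ (a ℤ.- ℤ.+ 1) ∷ (a ℤ.- ℤ.-[1+ 0 ]) ∷ []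

∈-near : ∀ a b → ∣ a ℤ.- b ∣ ℕ.≤ 1 → b ∈ near a
∈-near a b h = subst (_∈ near a) eq (small (a ℤ.- b) h)
  where
  open ≡-Reasoning
  small : ∀ d → ∣ d ∣ ℕ.≤ 1 → a ℤ.- d ∈ near a
  small (ℤ.+ 0)       _ = here refl
  small (ℤ.+ 1)       _ = there (here refl)
  small ℤ.-[1+ 0 ]    _ = there (there (here refl))
  small (ℤ.+ suc (suc _)) (ℕ.s≤s ())
  small ℤ.-[1+ suc _ ]    (ℕ.s≤s ())
  eq : a ℤ.- (a ℤ.- b) ≡ b
  eq = begin
    a ℤ.- (a ℤ.- b)               ≡⟨ cong (λ t → a ℤ.+ t) (ℤP.neg-distrib-+ a (ℤ.- b)) ⟩
    a ℤ.+ (ℤ.- a ℤ.- ℤ.- b)       ≡⟨ sym (ℤP.+-assoc a (ℤ.- a) _) ⟩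
    (a ℤ.- a) ℤ.- ℤ.- b           ≡⟨ cong₂ ℤ._+_ (ℤP.+-inverseʳ a) (ℤP.neg-involutive b) ⟩
    ℤ.+ 0 ℤ.+ b                   ≡⟨ ℤP.+-identityˡ b ⟩
    b                             ∎

nbhd : Point → List Point
nbhd (a , b , c) = cartesianProduct (near a) (cartesianProduct (near b) (near c))

∈-nbhd : ∀ p q → Close p q → q ∈ nbhd p
∈-nbhd (a , b , c) (a' , b' , c') (h₁ , h₂ , h₃) =
  ∈-cartesianProduct⁺ (∈-near a a' h₁) (∈-cartesianProduct⁺ (∈-near b b' h₂) (∈-near c c' h₃))

A⟨_,_⟩ : Point → Point → ℚ
A⟨ p , q ⟩ = ⟦ adj p q ⟧

-- 27 = 3 · 3 · 3 counts the whole box around `p`, including `p` itself and points off the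
-- octahedron.
outdegree : ∀ n p → Σℚ (verts n) (λ q → A⟨ p , q ⟩) ≤ℚ fromℕ 27
outdegree n p = count≤length (adj p) {ys = nbhd p} (verts-unique n) (λ {q} t → ∈-nbhd p q (adj⇒Close p q t))

indegree : ∀ n q → Σℚ (verts n) (λ p → A⟨ p , q ⟩) ≤ℚ fromℕ 27
indegree n q = count≤length (λ p → adj p q) {ys = nbhd q} (verts-unique n)
  (λ {p} t → ∈-nbhd q p (Close-sym p q (adj⇒Close p q t)))

-- The choice distribution and independence

invSq-nonneg : ∀ d → 0ℚ ≤ℚ invSq d
invSq-nonneg d = recip-nonneg (0≤fromℕ (d ℕ.* d))

Z-nonneg : ∀ n u → 0ℚ ≤ℚ Z n u
Z-nonneg n u = recip-nonneg (Σ-nonneg (others n u) (λ {w} _ → invSq-nonneg (dist n u w)))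

choiceProb-nonneg : ∀ n u v → 0ℚ ≤ℚ choiceProb n u v
choiceProb-nonneg n u v = *-nonneg (Z-nonneg n u) (invSq-nonneg (dist n u v))

Σ-choiceProb≤1 : ∀ n u → Σℚ (others n u) (choiceProb n u) ≤ℚ 1ℚ
Σ-choiceProb≤1 n u = ≤-trans
  (≤-reflexive (Σ-*ˡ (others n u) (Z n u) (λ w → invSq (dist n u w))))
  (recip*p≤1 (Σℚ (others n u) (λ w → invSq (dist n u w))))

-- Probability that a's choice satisfies Q.
P[_∙_∈_] : ℕ → Point → (Point → Bool) → ℚ
P[ n ∙ a ∈ Q ] = Σℚ (others n a) (λ c → choiceProb n a c *ℚ ⟦ Q c ⟧)

P-nonneg : ∀ n a Q → 0ℚ ≤ℚ P[ n ∙ a ∈ Q ]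
P-nonneg n a Q = Σ-nonneg (others n a) (λ {c} _ → *-nonneg (choiceProb-nonneg n a c) (0≤⟦⟧ (Q c)))

P-mono : ∀ n a {Q R} → (∀ c → T (Q c) → T (R c)) → P[ n ∙ a ∈ Q ] ≤ℚ P[ n ∙ a ∈ R ]
P-mono n a {Q} {R} Q⇒R = Σ-mono (others n a) (λ {c} _ →
  *-mono-≤ (choiceProb-nonneg n a c) ≤-refl (0≤⟦⟧ (Q c)) (⟦⟧-mono (Q c) (R c) (Q⇒R c)))
  where
  ⟦⟧-mono : ∀ b c → (T b → T c) → ⟦ b ⟧ ≤ℚ ⟦ c ⟧
  ⟦⟧-mono false c     _   = 0≤⟦⟧ c
  ⟦⟧-mono true  true  _   = ≤-refl
  ⟦⟧-mono true  false b⇒c = ⊥-elim (b⇒c tt)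

P≤1 : ∀ n a Q → P[ n ∙ a ∈ Q ] ≤ℚ 1ℚ
P≤1 n a Q = ≤-trans
  (P-mono n a {Q} {λ _ → true} (λ _ _ → tt))
  (≤-trans (≤-reflexive (Σ-cong (others n a) (λ c → *-identityʳ (choiceProb n a c)))) (Σ-choiceProb≤1 n a))

P-const : ∀ n a b → P[ n ∙ a ∈ (λ _ → b) ] ≤ℚ ⟦ b ⟧
P-const n a true  = P≤1 n a (λ _ → true)
P-const n a false = ≤-reflexive
  (trans (Σ-cong (others n a) (λ c → *-zeroʳ (choiceProb n a c))) (Σ-zero (others n a)))

-- Union bound against a condition `b` independent of the choice; if `b` holds, its indicator 1
-- already dominates.
P-∨ : ∀ n a b Q → P[ n ∙ a ∈ (λ c → b ∨ Q c) ] ≤ℚ ⟦ b ⟧ + P[ n ∙ a ∈ Q ]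
P-∨ n a true  Q = ≤-trans (P≤1 n a (λ _ → true)) (p≤p+q (P-nonneg n a Q))
P-∨ n a false Q = p≤q+p ≤-refl

-- Independence, as distributivity of the product over the sums.
Σ-outcomes : ∀ n (h : Point × Point → ℚ) vs →
  Σℚ (outcomesFor n vs) (λ o → Πℚ o h) ≡ Πℚ vs (λ v → Σℚ (others n v) (λ c → h (v , c)))
Σ-outcomes n h []       = +-identityʳ 1ℚ
Σ-outcomes n h (v ∷ vs) = begin
  Σℚ (outcomesFor n (v ∷ vs)) (λ o → Πℚ o h)
    ≡⟨ Σ-concatMap (outcomesFor n vs) _ _ ⟩
  Σℚ (outcomesFor n vs) (λ o → Σℚ (map (λ c → (v , c) ∷ o) (others n v)) (λ o → Πℚ o h))
    ≡⟨ Σ-cong (outcomesFor n vs) (λ o → trans (Σ-map (others n v) _ _) (Σ-*ʳ (others n v) (λ c → h (v , c)) (Πℚ o h))) ⟩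
  Σℚ (outcomesFor n vs) (λ o → s *ℚ Πℚ o h)
    ≡⟨ Σ-*ˡ (outcomesFor n vs) s _ ⟩
  s *ℚ Σℚ (outcomesFor n vs) (λ o → Πℚ o h)
    ≡⟨ cong (s *ℚ_) (Σ-outcomes n h vs) ⟩
  s *ℚ Πℚ vs (λ v → Σℚ (others n v) (λ c → h (v , c))) ∎
  where
  open ≡-Reasoning
  s = Σℚ (others n v) (λ c → h (v , c))

-- As `verts n` has no duplicates, every vertex occurs exactly once as a chooser, so an outcome is
-- the graph of a function.
outcome-tails : ∀ n vs {o} → o ∈ outcomesFor n vs → map proj₁ o ≡ vs
outcome-tails n []       (here refl) = refl
outcome-tails n (v ∷ vs) o∈
  with o' , o'∈ , o∈map ← find (∈-concatMap⁻ (λ rest → map (λ c → (v , c) ∷ rest) (others n v)) {xs = outcomesFor n vs} o∈)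
  with c , _ , refl ← ∈-map⁻ (λ c → (v , c) ∷ o') o∈map
  = cong (v ∷_) (outcome-tails n vs o'∈)

chose⇒∈ : ∀ o a b → T (chose o a b) → (a , b) ∈ o
chose⇒∈ o a b t with (v , c) , vc∈o , t' ← find (any⁻ _ o t) =
  let t₁ , t₂ = to (T-∧ {v == a}) t' in
  subst (_∈ o) (cong₂ _,_ (==⇒≡ v a t₁) (==⇒≡ c b t₂)) vc∈o

choice-functional : ∀ {o : Outcome} {a b c} → Unique (map proj₁ o) → (a , b) ∈ o → (a , c) ∈ o → b ≡ c
choice-functional (_ ∷ _)   (here refl) (here refl) = refl
choice-functional (a∉ ∷ _)  (here refl) (there ac∈) = contradiction refl (All.lookup a∉ (∈-map⁺ proj₁ ac∈))
choice-functional (a∉ ∷ _)  (there ab∈) (here refl) = contradiction refl (All.lookup a∉ (∈-map⁺ proj₁ ab∈))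
choice-functional (_ ∷ o!)  (there ab∈) (there ac∈) = choice-functional o! ab∈ ac∈

-- Each condition is guarded by its vertex, so a joint condition on three choices becomes a test of
-- every entry separately.
compatible : (u x y : Point) (Q₁ Q₂ Q₃ : Point → Bool) → Point × Point → Bool
compatible u x y Q₁ Q₂ Q₃ (v , c) =
  (not (v == u) ∨ Q₁ c) ∧ (not (v == x) ∨ Q₂ c) ∧ (not (v == y) ∨ Q₃ c)

guarded : ∀ v a {b : Bool} → (v ≡ a → T b) → T (not (v == a) ∨ b)
guarded v a h with v == a in eq
... | true  = h (==⇒≡ v a (from T-≡ eq))
... | false = tt

unguard : ∀ a {b} → T (not (a == a) ∨ b) → T b
unguard a t with a == a | ==-refl a
... | true | _ = t

compatible⁺ : ∀ u x y Q₁ Q₂ Q₃ {v c} → (v ≡ u → T (Q₁ c)) → (v ≡ x → T (Q₂ c)) → (v ≡ y → T (Q₃ c)) →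
              T (compatible u x y Q₁ Q₂ Q₃ (v , c))
compatible⁺ u x y Q₁ Q₂ Q₃ {v} {c} h₁ h₂ h₃ =
  from (T-∧ {not (v == u) ∨ Q₁ c}) (guarded v u h₁ ,
  from (T-∧ {not (v == x) ∨ Q₂ c}) (guarded v x h₂ , guarded v y h₃))

-- The weight of `o` if all its entries pass the test and 0 otherwise. Placing the indicator inside
-- the product keeps the form that `Σ-outcomes` factorises.
compatibleWeight : ℕ → (u x y : Point) (Q₁ Q₂ Q₃ : Point → Bool) → Outcome → ℚ
compatibleWeight n u x y Q₁ Q₂ Q₃ o =
  Πℚ o (λ { (v , c) → choiceProb n v c *ℚ ⟦ compatible u x y Q₁ Q₂ Q₃ (v , c) ⟧ })

compatibleWeight-nonneg : ∀ n u x y Q₁ Q₂ Q₃ o → 0ℚ ≤ℚ compatibleWeight n u x y Q₁ Q₂ Q₃ o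
compatibleWeight-nonneg n u x y Q₁ Q₂ Q₃ o =
  Π-nonneg o (λ { (v , c) → *-nonneg (choiceProb-nonneg n v c) (0≤⟦⟧ (compatible u x y Q₁ Q₂ Q₃ (v , c))) })

weight≡compatibleWeight : ∀ n u x y Q₁ Q₂ Q₃ o →
  (∀ {e} → e ∈ o → T (compatible u x y Q₁ Q₂ Q₃ e)) → weight n o ≡ compatibleWeight n u x y Q₁ Q₂ Q₃ o
weight≡compatibleWeight n u x y Q₁ Q₂ Q₃ []            h = refl
weight≡compatibleWeight n u x y Q₁ Q₂ Q₃ ((v , c) ∷ o) h = cong₂ _*ℚ_
  (trans (sym (*-identityʳ (choiceProb n v c))) (cong (λ b → choiceProb n v c *ℚ ⟦ b ⟧) (sym (to T-≡ (h (here refl))))))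
  (weight≡compatibleWeight n u x y Q₁ Q₂ Q₃ o (h ∘ there))

-- The sum factorises over the vertices, and the factors other than those of `u`, `x`, `y` are at
-- most 1. Distinctness lets these three be extracted as separate factors.
Σ-compatibleWeight : ∀ n {u x y} Q₁ Q₂ Q₃ → Unique (u ∷ x ∷ y ∷ []) →
  u ∈ verts n → x ∈ verts n → y ∈ verts n →
  Σℚ (outcomes n) (compatibleWeight n u x y Q₁ Q₂ Q₃) ≤ℚ
    P[ n ∙ u ∈ Q₁ ] *ℚ (P[ n ∙ x ∈ Q₂ ] *ℚ P[ n ∙ y ∈ Q₃ ])
Σ-compatibleWeight n {u} {x} {y} Q₁ Q₂ Q₃ uxy! u∈ x∈ y∈ = begin
  Σℚ (outcomes n) (compatibleWeight n u x y Q₁ Q₂ Q₃)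
    ≡⟨ Σ-outcomes n _ (verts n) ⟩
  Πℚ (verts n) s
    ≤⟨ Π-⊆ uxy! ⊆verts (λ {v} _ → 0≤s v , P≤1 n v _) ⟩
  s u *ℚ (s x *ℚ (s y *ℚ 1ℚ))
    ≡⟨ cong (λ t → s u *ℚ (s x *ℚ t)) (*-identityʳ (s y)) ⟩
  s u *ℚ (s x *ℚ s y)
    ≤⟨ *-mono-≤ (0≤s u) s-u (*-nonneg (0≤s x) (0≤s y)) (*-mono-≤ (0≤s x) s-x (0≤s y) s-y) ⟩
  P[ n ∙ u ∈ Q₁ ] *ℚ (P[ n ∙ x ∈ Q₂ ] *ℚ P[ n ∙ y ∈ Q₃ ]) ∎
  where
  open ≤-Reasoning
  G : Point → Point → Bool
  G v c = compatible u x y Q₁ Q₂ Q₃ (v , c)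
  s : Point → ℚ
  s v = P[ n ∙ v ∈ G v ]
  0≤s : ∀ v → 0ℚ ≤ℚ s v
  0≤s v = P-nonneg n v (G v)
  ⊆verts : (u ∷ x ∷ y ∷ []) ⊆ verts n
  ⊆verts (here refl)                 = u∈
  ⊆verts (there (here refl))         = x∈
  ⊆verts (there (there (here refl))) = y∈
  -- At `u` its own guard is open, so the test implies `Q₁`; the other two conjuncts are dropped by
  -- monotonicity.
  s-u : s u ≤ℚ P[ n ∙ u ∈ Q₁ ]
  s-u = P-mono n u (λ c t → unguard u (proj₁ (to (T-∧ {not (u == u) ∨ Q₁ c}) t)))
  s-x : s x ≤ℚ P[ n ∙ x ∈ Q₂ ]
  s-x = P-mono n x (λ c t → unguard x (proj₁ (to (T-∧ {not (x == x) ∨ Q₂ c}) (proj₂ (to (T-∧ {not (x == u) ∨ Q₁ c}) t)))))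
  s-y : s y ≤ℚ P[ n ∙ y ∈ Q₃ ]
  s-y = P-mono n y (λ c t → unguard y (proj₂ (to (T-∧ {not (y == x) ∨ Q₂ c}) (proj₂ (to (T-∧ {not (y == u) ∨ Q₁ c}) t)))))

-- The union bound over triangles

-- The three ways in which a triangle u → x → y → u can have a long arc, by the last arc that is not
-- an edge of G'ₙ; the arcs before it may be of either kind.
last : ℕ → Point → Point → Point → Outcome → ℚ
last n u x y = compatibleWeight n u x y (λ c → adj u x ∨ (c == x)) (λ c → adj x y ∨ (c == y)) (_== u)

middle : ℕ → Point → Point → Point → Outcome → ℚ
middle n u x y = compatibleWeight n u x y (λ c → adj u x ∨ (c == x)) (_== y) (λ _ → adj y u)

first : ℕ → Point → Point → Point → Outcome → ℚ
first n u x y = compatibleWeight n u x y (_== x) (λ _ → adj x y) (λ _ → adj y u)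

distinct : Point → Point → Point → Bool
distinct u x y = not (u == x) ∧ not (u == y) ∧ not (x == y)

-- Zero on degenerate triples, so that `x` and `y` may range over all of `verts n` although the
-- product bound needs distinct vertices.
triangle : ℕ → Point → Point → Point → Outcome → ℚ
triangle n u x y o = if distinct u x y then last n u x y o + (middle n u x y o + first n u x y o) else 0ℚ

triangle-nonneg : ∀ n u x y o → 0ℚ ≤ℚ triangle n u x y o
triangle-nonneg n u x y o with distinct u x y
... | false = ≤-refl
... | true  = +-nonneg (compatibleWeight-nonneg n u x y _ _ _ o)
                (+-nonneg (compatibleWeight-nonneg n u x y _ _ _ o) (compatibleWeight-nonneg n u x y _ _ _ o))

weight≤triangle : ∀ n u x y {o} → o ∈ outcomes n → T (distinct u x y) →
  T (arc o u x) → T (arc o x y) → T (arc o y u) →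
  T (longArc o u x ∨ longArc o x y ∨ longArc o y u) → weight n o ≤ℚ triangle n u x y o
weight≤triangle n u x y {o} o∈ d ux xy yu long
  with distinct u x y | d
... | true | _ = by-arcs (to (T-∨ {adj u x}) ux) (to (T-∨ {adj x y}) xy) (to (T-∨ {adj y u}) yu)
  where
  W = compatibleWeight n u x y
  0≤W : ∀ Q₁ Q₂ Q₃ → 0ℚ ≤ℚ W Q₁ Q₂ Q₃ o
  0≤W Q₁ Q₂ Q₃ = compatibleWeight-nonneg n u x y Q₁ Q₂ Q₃ o

  chooses : ∀ a b → T (chose o a b) → ∀ v c → (v , c) ∈ o → v ≡ a → T (c == b)
  chooses a b t .a c ac∈o refl =
    subst (λ c → T (c == b))
      (choice-functional (subst Unique (sym (outcome-tails n (verts n) o∈)) (verts-unique n)) (chose⇒∈ o a b t) ac∈o)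
      (==-refl b)

  arc-chooses : ∀ a b → T (arc o a b) → ∀ v c → (v , c) ∈ o → v ≡ a → T (adj a b ∨ (c == b))
  arc-chooses a b t v c vc∈o v≡a with to (T-∨ {adj a b}) t
  ... | inj₁ e = from (T-∨ {adj a b}) (inj₁ e)
  ... | inj₂ e = from (T-∨ {adj a b}) (inj₂ (chooses a b e v c vc∈o v≡a))

  short : ∀ {a b} → T (adj a b) → ¬ T (longArc o a b)
  short {a} {b} e l = subst T (to (T-not-≡ {adj a b}) (proj₁ (to (T-∧ {not (adj a b)}) l))) e

  weight≤W : ∀ Q₁ Q₂ Q₃ →
       (∀ v c → (v , c) ∈ o → v ≡ u → T (Q₁ c)) →
       (∀ v c → (v , c) ∈ o → v ≡ x → T (Q₂ c)) →
       (∀ v c → (v , c) ∈ o → v ≡ y → T (Q₃ c)) → weight n o ≤ℚ W Q₁ Q₂ Q₃ o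
  weight≤W Q₁ Q₂ Q₃ h₁ h₂ h₃ = ≤-reflexive (weight≡compatibleWeight n u x y Q₁ Q₂ Q₃ o
    (λ {(v , c)} e → compatible⁺ u x y Q₁ Q₂ Q₃ (h₁ v c e) (h₂ v c e) (h₃ v c e)))

  by-arcs : T (adj u x) ⊎ T (chose o u x) → T (adj x y) ⊎ T (chose o x y) → T (adj y u) ⊎ T (chose o y u) →
            weight n o ≤ℚ last n u x y o + (middle n u x y o + first n u x y o)
  -- The arcs are inspected from the last one backwards: the first choice met selects the summand
  -- that equals the weight, the other two being nonnegative.
  by-arcs _ _ (inj₂ yu) = ≤-trans
    (weight≤W _ _ _ (arc-chooses u x ux) (arc-chooses x y xy) (chooses y u yu))
    (p≤p+q (+-nonneg (0≤W _ _ _) (0≤W _ _ _)))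
  by-arcs _ (inj₂ xy) (inj₁ yu) = ≤-trans
    (weight≤W _ _ (λ _ → adj y u) (arc-chooses u x ux) (chooses x y xy) (λ _ _ _ _ → yu))
    (≤-trans (p≤p+q (0≤W _ _ _)) (p≤q+p (0≤W _ _ _)))
  by-arcs (inj₂ ux) (inj₁ xy) (inj₁ yu) = ≤-trans
    (weight≤W _ (λ _ → adj x y) (λ _ → adj y u) (chooses u x ux) (λ _ _ _ _ → xy) (λ _ _ _ _ → yu))
    (≤-trans (p≤q+p (0≤W _ _ _)) (p≤q+p (0≤W _ _ _)))
  by-arcs (inj₁ ux) (inj₁ xy) (inj₁ yu) with to (T-∨ {longArc o u x}) long
  ... | inj₁ l = contradiction l (short ux)
  ... | inj₂ l with to (T-∨ {longArc o x y}) l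
  ...   | inj₁ l = contradiction l (short xy)
  ...   | inj₂ l = contradiction l (short yu)

eventE⇒weight≤ : ∀ n u {o} → o ∈ outcomes n →
  (if eventE n u o then weight n o else 0ℚ) ≤ℚ Σℚ (verts n) (λ x → Σℚ (verts n) (λ y → triangle n u x y o))
eventE⇒weight≤ n u {o} o∈ with eventE n u o in eq
... | false = Σ-nonneg (verts n) (λ _ → Σ-nonneg (verts n) (λ _ → triangle-nonneg n u _ _ o))
... | true
  with x , x∈ , tx ← find (any⁻ _ (verts n) (from T-≡ eq))
  with y , y∈ , t  ← find (any⁻ _ (verts n) tx)
  = let d₁ , t  = to (T-∧ {not (u == x)}) t
        d₂ , t  = to (T-∧ {not (u == y)}) t
        d₃ , t  = to (T-∧ {not (x == y)}) t
        ux , t  = to (T-∧ {arc o u x}) t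
        xy , t  = to (T-∧ {arc o x y}) t
        yu , l  = to (T-∧ {arc o y u}) t
    in ≤-trans (weight≤triangle n u x y o∈ (from T-∧ (d₁ , from T-∧ (d₂ , d₃))) ux xy yu l)
         (≤-trans (x≤Σ (λ {y} _ → triangle-nonneg n u x y o) y∈)
           (x≤Σ (λ {x} _ → Σ-nonneg (verts n) (λ {y} _ → triangle-nonneg n u x y o)) x∈))

28ℚ : ℚ
28ℚ = fromℕ 28

q : ℕ → Point → Point → ℚ
q n a b = P[ n ∙ a ∈ _== b ]

-- Bounds the probability that the arc from `a` to `b` is present, as an edge or as a choice.
r : ℕ → Point → Point → ℚ
r n a b = A⟨ a , b ⟩ + q n a b

q-nonneg : ∀ n a b → 0ℚ ≤ℚ q n a b
q-nonneg n a b = P-nonneg n a (_== b)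

r-nonneg : ∀ n a b → 0ℚ ≤ℚ r n a b
r-nonneg n a b = +-nonneg (0≤⟦⟧ (adj a b)) (q-nonneg n a b)

-- After exchanging the sums, each choice `c` is counted for at most one target `b`.
Σ-q≤1 : ∀ n a → Σℚ (verts n) (q n a) ≤ℚ 1ℚ
Σ-q≤1 n a = begin
  Σℚ (verts n) (λ b → Σℚ (others n a) (λ c → choiceProb n a c *ℚ ⟦ c == b ⟧))
    ≡⟨ Σ-swap (verts n) (others n a) (λ b c → choiceProb n a c *ℚ ⟦ c == b ⟧) ⟩
  Σℚ (others n a) (λ c → Σℚ (verts n) (λ b → choiceProb n a c *ℚ ⟦ c == b ⟧))
    ≤⟨ Σ-mono (others n a) (λ {c} _ → at-most-once c) ⟩
  Σℚ (others n a) (choiceProb n a)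
    ≤⟨ Σ-choiceProb≤1 n a ⟩
  1ℚ ∎
  where
  open ≤-Reasoning
  at-most-once : ∀ c → Σℚ (verts n) (λ b → choiceProb n a c *ℚ ⟦ c == b ⟧) ≤ℚ choiceProb n a c
  at-most-once c = begin
    Σℚ (verts n) (λ b → choiceProb n a c *ℚ ⟦ c == b ⟧)
      ≡⟨ Σ-*ˡ (verts n) (choiceProb n a c) (λ b → ⟦ c == b ⟧) ⟩
    choiceProb n a c *ℚ Σℚ (verts n) (λ b → ⟦ c == b ⟧)
      ≤⟨ *-monoˡ-≤-nonNeg (choiceProb n a c) {{ℚ.nonNegative (choiceProb-nonneg n a c)}}
           (count≤length (c ==_) {ys = [ c ]} (verts-unique n) (λ {b} t → here (sym (==⇒≡ c b t)))) ⟩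
    choiceProb n a c *ℚ 1ℚ
      ≡⟨ *-identityʳ (choiceProb n a c) ⟩
    choiceProb n a c ∎

Σ-r≤28 : ∀ n a → Σℚ (verts n) (r n a) ≤ℚ 28ℚ
Σ-r≤28 n a = begin
  Σℚ (verts n) (r n a)                                      ≡⟨ Σ-+ (verts n) (λ b → A⟨ a , b ⟩) (q n a) ⟩
  Σℚ (verts n) (λ b → A⟨ a , b ⟩) + Σℚ (verts n) (q n a)    ≤⟨ +-mono-≤ (outdegree n a) (Σ-q≤1 n a) ⟩
  fromℕ 27 + fromℕ 1                                        ≡⟨ sym (fromℕ-+ 27 1) ⟩
  28ℚ                                                       ∎
  where open ≤-Reasoning

Σ-if : ∀ {A : Set} (xs : List A) b f {B} → 0ℚ ≤ℚ B → (T b → Σℚ xs f ≤ℚ B) →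
       Σℚ xs (λ x → if b then f x else 0ℚ) ≤ℚ B
Σ-if xs true  f 0≤B h = h tt
Σ-if xs false f 0≤B h = ≤-trans (≤-reflexive (Σ-zero xs)) 0≤B

-- Each arc becomes one factor: `r` if both kinds are allowed, `q` for the long arc, and `A` for an
-- arc required to be an edge, which is a constant predicate and falls under `P-const`.
Σ-kinds : ∀ n {u x y} → u ∈ verts n → x ∈ verts n → y ∈ verts n → Unique (u ∷ x ∷ y ∷ []) →
  Σℚ (outcomes n) (λ o → last n u x y o + (middle n u x y o + first n u x y o)) ≤ℚ
    r n u x *ℚ (r n x y *ℚ q n y u) + (r n u x *ℚ (q n x y *ℚ A⟨ y , u ⟩) + q n u x *ℚ (A⟨ x , y ⟩ *ℚ A⟨ y , u ⟩))
Σ-kinds n {u} {x} {y} u∈ x∈ y∈ uxy! = begin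
  Σℚ (outcomes n) (λ o → last n u x y o + (middle n u x y o + first n u x y o))
    ≡⟨ Σ-+ (outcomes n) (last n u x y) (λ o → middle n u x y o + first n u x y o) ⟩
  Σℚ (outcomes n) (last n u x y) + Σℚ (outcomes n) (λ o → middle n u x y o + first n u x y o)
    ≡⟨ cong (Σℚ (outcomes n) (last n u x y) +_) (Σ-+ (outcomes n) (middle n u x y) (first n u x y)) ⟩
  Σℚ (outcomes n) (last n u x y) + (Σℚ (outcomes n) (middle n u x y) + Σℚ (outcomes n) (first n u x y))
    ≤⟨ +-mono-≤
         (bound (λ c → adj u x ∨ (c == x)) (λ c → adj x y ∨ (c == y)) (_== u)
           (P-∨ n u (adj u x) (_== x)) (P-∨ n x (adj x y) (_== y)) ≤-refl)
         (+-mono-≤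
           (bound (λ c → adj u x ∨ (c == x)) (_== y) (λ _ → adj y u)
             (P-∨ n u (adj u x) (_== x)) ≤-refl (P-const n y (adj y u)))
           (bound (_== x) (λ _ → adj x y) (λ _ → adj y u)
             ≤-refl (P-const n x (adj x y)) (P-const n y (adj y u)))) ⟩
  r n u x *ℚ (r n x y *ℚ q n y u) + (r n u x *ℚ (q n x y *ℚ A⟨ y , u ⟩) + q n u x *ℚ (A⟨ x , y ⟩ *ℚ A⟨ y , u ⟩)) ∎
  where
  open ≤-Reasoning
  bound : ∀ Q₁ Q₂ Q₃ {b₁ b₂ b₃} → P[ n ∙ u ∈ Q₁ ] ≤ℚ b₁ → P[ n ∙ x ∈ Q₂ ] ≤ℚ b₂ → P[ n ∙ y ∈ Q₃ ] ≤ℚ b₃ →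
          Σℚ (outcomes n) (compatibleWeight n u x y Q₁ Q₂ Q₃) ≤ℚ b₁ *ℚ (b₂ *ℚ b₃)
  bound Q₁ Q₂ Q₃ h₁ h₂ h₃ = ≤-trans (Σ-compatibleWeight n Q₁ Q₂ Q₃ uxy! u∈ x∈ y∈)
    (*-mono-≤ (P-nonneg n u Q₁) h₁
      (*-nonneg (P-nonneg n x Q₂) (P-nonneg n y Q₃))
      (*-mono-≤ (P-nonneg n x Q₂) h₂ (P-nonneg n y Q₃) h₃))

Σ-triangle : ∀ n {u x y} → u ∈ verts n → x ∈ verts n → y ∈ verts n →
  Σℚ (outcomes n) (triangle n u x y) ≤ℚ
    r n u x *ℚ (r n x y *ℚ q n y u) + (r n u x *ℚ (q n x y *ℚ A⟨ y , u ⟩) + q n u x *ℚ (A⟨ x , y ⟩ *ℚ A⟨ y , u ⟩))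
Σ-triangle n {u} {x} {y} u∈ x∈ y∈ =
  Σ-if (outcomes n) (distinct u x y) (λ o → last n u x y o + (middle n u x y o + first n u x y o))
    (+-nonneg (*-nonneg (r-nonneg n u x) (*-nonneg (r-nonneg n x y) (q-nonneg n y u)))
    (+-nonneg (*-nonneg (r-nonneg n u x) (*-nonneg (q-nonneg n x y) (0≤⟦⟧ (adj y u))))
              (*-nonneg (q-nonneg n u x) (*-nonneg (0≤⟦⟧ (adj x y)) (0≤⟦⟧ (adj y u))))))
    (λ d → Σ-kinds n u∈ x∈ y∈ (distinct⇒Unique d))
  where
  distinct⇒Unique : T (distinct u x y) → Unique (u ∷ x ∷ y ∷ [])
  distinct⇒Unique d =
    let d₁ , d₂₃ = to (T-∧ {not (u == x)}) d
        d₂ , d₃  = to (T-∧ {not (u == y)}) d₂₃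
    in (not-==⇒≢ u x d₁ ∷ not-==⇒≢ u y d₂ ∷ []) ∷ (not-==⇒≢ x y d₃ ∷ []) ∷ [] ∷ []

PrE≤Σ-triangle : ∀ n u →
  PrE n u ≤ℚ Σℚ (verts n) (λ x → Σℚ (verts n) (λ y → Σℚ (outcomes n) (triangle n u x y)))
PrE≤Σ-triangle n u = begin
  PrE n u
    ≤⟨ Σ-mono (outcomes n) (eventE⇒weight≤ n u) ⟩
  Σℚ (outcomes n) (λ o → Σℚ (verts n) (λ x → Σℚ (verts n) (λ y → triangle n u x y o)))
    ≡⟨ Σ-swap (outcomes n) (verts n) (λ o x → Σℚ (verts n) (λ y → triangle n u x y o)) ⟩
  Σℚ (verts n) (λ x → Σℚ (outcomes n) (λ o → Σℚ (verts n) (λ y → triangle n u x y o)))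
    ≡⟨ Σ-cong (verts n) (λ x → Σ-swap (outcomes n) (verts n) (λ o y → triangle n u x y o)) ⟩
  Σℚ (verts n) (λ x → Σℚ (verts n) (λ y → Σℚ (outcomes n) (triangle n u x y))) ∎
  where open ≤-Reasoning

-- Summing over triangles, given a uniform bound on the choice probabilities

module _ (n : ℕ) {ζ : ℚ} (0≤ζ : 0ℚ ≤ℚ ζ)
         (choiceProb≤ζ : ∀ {a} → a ∈ verts n → ∀ c → choiceProb n a c ≤ℚ ζ) where
  open ≤-Reasoning

  private
    V = verts n
    0≤28 : 0ℚ ≤ℚ 28ℚ
    0≤28 = 0≤fromℕ 28

  q≤ζ : ∀ {a} → a ∈ V → ∀ b → q n a b ≤ℚ ζ
  q≤ζ {a} a∈ b = begin
    Σℚ (others n a) (λ c → choiceProb n a c *ℚ ⟦ c == b ⟧)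
      ≤⟨ Σ-mono (others n a) (λ {c} _ → *-mono-≤ (choiceProb-nonneg n a c) (choiceProb≤ζ a∈ c) (0≤⟦⟧ (c == b)) ≤-refl) ⟩
    Σℚ (others n a) (λ c → ζ *ℚ ⟦ c == b ⟧)
      ≡⟨ Σ-*ˡ (others n a) ζ (λ c → ⟦ c == b ⟧) ⟩
    ζ *ℚ Σℚ (others n a) (λ c → ⟦ c == b ⟧)
      ≤⟨ *-monoˡ-≤-nonNeg ζ {{ℚ.nonNegative 0≤ζ}} (count-==≤1 b (others-unique n a)) ⟩
    ζ *ℚ 1ℚ
      ≡⟨ *-identityʳ ζ ⟩
    ζ ∎

  -- Weakened from 27 so that the three cases end in the same bound.
  indegree≤28 : ∀ y → Σℚ V (λ x → A⟨ x , y ⟩) ≤ℚ 28ℚ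
  indegree≤28 y = ≤-trans (indegree n y) (fromℕ-mono (ℕP.n≤1+n 27))

  -- Both sums run forwards: over `y` along the arcs leaving `x`, then over `x` along the arcs
  -- leaving `u`.
  Σ-last : ∀ u → Σℚ V (λ x → Σℚ V (λ y → r n u x *ℚ (r n x y *ℚ ζ))) ≤ℚ 28ℚ *ℚ 28ℚ *ℚ ζ
  Σ-last u = begin
    Σℚ V (λ x → Σℚ V (λ y → r n u x *ℚ (r n x y *ℚ ζ)))
      ≡⟨ Σ-cong V (λ x → trans (Σ-*ˡ V (r n u x) (λ y → r n x y *ℚ ζ)) (cong (r n u x *ℚ_) (Σ-*ʳ V (r n x) ζ))) ⟩
    Σℚ V (λ x → r n u x *ℚ (Σℚ V (r n x) *ℚ ζ))
      ≤⟨ Σ-mono V (λ {x} _ → *-mono-≤ (r-nonneg n u x) ≤-refl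
           (*-nonneg (Σ-nonneg V (λ {y} _ → r-nonneg n x y)) 0≤ζ)
           (*-monoʳ-≤-nonNeg ζ {{ℚ.nonNegative 0≤ζ}} (Σ-r≤28 n x))) ⟩
    Σℚ V (λ x → r n u x *ℚ (28ℚ *ℚ ζ))
      ≡⟨ Σ-*ʳ V (r n u) (28ℚ *ℚ ζ) ⟩
    Σℚ V (r n u) *ℚ (28ℚ *ℚ ζ)
      ≤⟨ *-monoʳ-≤-nonNeg (28ℚ *ℚ ζ) {{ℚ.nonNegative (*-nonneg 0≤28 0≤ζ)}} (Σ-r≤28 n u) ⟩
    28ℚ *ℚ (28ℚ *ℚ ζ)
      ≡⟨ sym (*-assoc 28ℚ 28ℚ ζ) ⟩
    28ℚ *ℚ 28ℚ *ℚ ζ ∎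

  -- With the arc between `x` and `y` replaced by `ζ`, the double sum separates: `x` runs along arcs
  -- leaving `u`, `y` along edges entering `u`.
  Σ-middle : ∀ u → Σℚ V (λ x → Σℚ V (λ y → r n u x *ℚ (ζ *ℚ A⟨ y , u ⟩))) ≤ℚ 28ℚ *ℚ 28ℚ *ℚ ζ
  Σ-middle u = begin
    Σℚ V (λ x → Σℚ V (λ y → r n u x *ℚ (ζ *ℚ A⟨ y , u ⟩)))
      ≡⟨ Σ-cong V (λ x → trans (Σ-*ˡ V (r n u x) (λ y → ζ *ℚ A⟨ y , u ⟩)) (cong (r n u x *ℚ_) (Σ-*ˡ V ζ (λ y → A⟨ y , u ⟩)))) ⟩
    Σℚ V (λ x → r n u x *ℚ (ζ *ℚ Σℚ V (λ y → A⟨ y , u ⟩)))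
      ≡⟨ Σ-*ʳ V (r n u) _ ⟩
    Σℚ V (r n u) *ℚ (ζ *ℚ Σℚ V (λ y → A⟨ y , u ⟩))
      ≤⟨ *-mono-≤ (Σ-nonneg V (λ {y} _ → r-nonneg n u y)) (Σ-r≤28 n u)
           (*-nonneg 0≤ζ (Σ-nonneg V (λ {y} _ → 0≤⟦⟧ (adj y u))))
           (*-monoˡ-≤-nonNeg ζ {{ℚ.nonNegative 0≤ζ}} (indegree≤28 u)) ⟩
    28ℚ *ℚ (ζ *ℚ 28ℚ)
      ≡⟨ cong (28ℚ *ℚ_) (*-comm ζ 28ℚ) ⟩
    28ℚ *ℚ (28ℚ *ℚ ζ)
      ≡⟨ sym (*-assoc 28ℚ 28ℚ ζ) ⟩
    28ℚ *ℚ 28ℚ *ℚ ζ ∎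

  -- Both sums run backwards along edges, over `x` into `y` and then over `y` into `u`; hence the
  -- exchange of sums.
  Σ-first : ∀ u → Σℚ V (λ x → Σℚ V (λ y → ζ *ℚ (A⟨ x , y ⟩ *ℚ A⟨ y , u ⟩))) ≤ℚ 28ℚ *ℚ 28ℚ *ℚ ζ
  Σ-first u = begin
    Σℚ V (λ x → Σℚ V (λ y → ζ *ℚ (A⟨ x , y ⟩ *ℚ A⟨ y , u ⟩)))
      ≡⟨ Σ-swap V V (λ x y → ζ *ℚ (A⟨ x , y ⟩ *ℚ A⟨ y , u ⟩)) ⟩
    Σℚ V (λ y → Σℚ V (λ x → ζ *ℚ (A⟨ x , y ⟩ *ℚ A⟨ y , u ⟩)))
      ≡⟨ Σ-cong V (λ y → trans (Σ-*ˡ V ζ (λ x → A⟨ x , y ⟩ *ℚ A⟨ y , u ⟩)) (cong (ζ *ℚ_) (Σ-*ʳ V (λ x → A⟨ x , y ⟩) A⟨ y , u ⟩))) ⟩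
    Σℚ V (λ y → ζ *ℚ (Σℚ V (λ x → A⟨ x , y ⟩) *ℚ A⟨ y , u ⟩))
      ≤⟨ Σ-mono V (λ {y} _ → *-monoˡ-≤-nonNeg ζ {{ℚ.nonNegative 0≤ζ}}
           (*-monoʳ-≤-nonNeg A⟨ y , u ⟩ {{ℚ.nonNegative (0≤⟦⟧ (adj y u))}} (indegree≤28 y))) ⟩
    Σℚ V (λ y → ζ *ℚ (28ℚ *ℚ A⟨ y , u ⟩))
      ≡⟨ trans (Σ-*ˡ V ζ (λ y → 28ℚ *ℚ A⟨ y , u ⟩)) (cong (ζ *ℚ_) (Σ-*ˡ V 28ℚ (λ y → A⟨ y , u ⟩))) ⟩
    ζ *ℚ (28ℚ *ℚ Σℚ V (λ y → A⟨ y , u ⟩))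
      ≤⟨ *-monoˡ-≤-nonNeg ζ {{ℚ.nonNegative 0≤ζ}} (*-monoˡ-≤-nonNeg 28ℚ (indegree≤28 u)) ⟩
    ζ *ℚ (28ℚ *ℚ 28ℚ)
      ≡⟨ *-comm ζ (28ℚ *ℚ 28ℚ) ⟩
    28ℚ *ℚ 28ℚ *ℚ ζ ∎

  PrE≤ : ∀ {u} → u ∈ V → PrE n u ≤ℚ 28ℚ *ℚ 28ℚ *ℚ ζ + (28ℚ *ℚ 28ℚ *ℚ ζ + 28ℚ *ℚ 28ℚ *ℚ ζ)
  PrE≤ {u} u∈ = begin
    PrE n u
      ≤⟨ PrE≤Σ-triangle n u ⟩
    Σℚ V (λ x → Σℚ V (λ y → Σℚ (outcomes n) (triangle n u x y)))
      -- In each summand exactly one factor `q`, that of the long arc, is replaced by `ζ`.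
      ≤⟨ Σ-mono V (λ {x} x∈ → Σ-mono V (λ {y} y∈ → ≤-trans (Σ-triangle n u∈ x∈ y∈)
           (+-mono-≤ (*-mono-≤ (r-nonneg n u x) ≤-refl (*-nonneg (r-nonneg n x y) (q-nonneg n y u))
                       (*-mono-≤ (r-nonneg n x y) ≤-refl (q-nonneg n y u) (q≤ζ y∈ u)))
           (+-mono-≤ (*-mono-≤ (r-nonneg n u x) ≤-refl (*-nonneg (q-nonneg n x y) (0≤⟦⟧ (adj y u)))
                       (*-mono-≤ (q-nonneg n x y) (q≤ζ x∈ y) (0≤⟦⟧ (adj y u)) ≤-refl))
                     (*-mono-≤ (q-nonneg n u x) (q≤ζ u∈ x) (*-nonneg (0≤⟦⟧ (adj x y)) (0≤⟦⟧ (adj y u))) ≤-refl))))) ⟩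
    Σℚ V (λ x → Σℚ V (λ y → f x y + (g x y + h x y)))
      ≡⟨ Σ²-+ f (λ x y → g x y + h x y) ⟩
    Σℚ V (λ x → Σℚ V (f x)) + Σℚ V (λ x → Σℚ V (λ y → g x y + h x y))
      ≡⟨ cong (Σℚ V (λ x → Σℚ V (f x)) +_) (Σ²-+ g h) ⟩
    Σℚ V (λ x → Σℚ V (f x)) + (Σℚ V (λ x → Σℚ V (g x)) + Σℚ V (λ x → Σℚ V (h x)))
      ≤⟨ +-mono-≤ (Σ-last u) (+-mono-≤ (Σ-middle u) (Σ-first u)) ⟩
    28ℚ *ℚ 28ℚ *ℚ ζ + (28ℚ *ℚ 28ℚ *ℚ ζ + 28ℚ *ℚ 28ℚ *ℚ ζ) ∎
    where
    f g h : Point → Point → ℚ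
    f x y = r n u x *ℚ (r n x y *ℚ ζ)
    g x y = r n u x *ℚ (ζ *ℚ A⟨ y , u ⟩)
    h x y = ζ *ℚ (A⟨ x , y ⟩ *ℚ A⟨ y , u ⟩)
    Σ²-+ : ∀ (f g : Point → Point → ℚ) → Σℚ V (λ x → Σℚ V (λ y → f x y + g x y)) ≡ Σℚ V (λ x → Σℚ V (f x)) + Σℚ V (λ x → Σℚ V (g x))
    Σ²-+ f g = trans (Σ-cong V (λ x → Σ-+ V (f x) (g x))) (Σ-+ V (λ x → Σℚ V (f x)) (λ x → Σℚ V (g x)))

-- The normaliser

-- True for any amount of fuel: the counter advances only past levels where `reach` fails, so never
-- past `k`, and it is the value returned when the fuel runs out.
distSearch≤ : ∀ n u w f {j k} → j ℕ.≤ k → T (reach n k u w) → distSearch n u w f j ℕ.≤ k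
distSearch≤ n u w zero    j≤k _ = j≤k
distSearch≤ n u w (suc f) {j} {k} j≤k t with reach n j u w in eq
... | true  = j≤k
... | false = distSearch≤ n u w f (ℕP.≤∧≢⇒< j≤k (λ { refl → subst T eq t })) t

distSearch≥ : ∀ n u w f j → j ℕ.≤ distSearch n u w f j
distSearch≥ n u w zero    j = ℕP.≤-refl
distSearch≥ n u w (suc f) j with reach n j u w
... | true  = ℕP.≤-refl
... | false = ℕP.<⇒≤ (distSearch≥ n u w f (suc j))

dist≤ : ∀ n {u w k} → T (reach n k u w) → dist n u w ℕ.≤ k
dist≤ n {u} {w} = distSearch≤ n u w (length (verts n)) ℕ.z≤n

-- The vertex `v` serves to make the fuel positive, since an empty search returns 0. Positivity
-- matters because `invSq 0` is 0.
dist>0 : ∀ n {u w v} → v ∈ verts n → u ≢ w → 0 ℕ.< dist n u w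
dist>0 n {u} {w} v∈ u≢w = search (length (verts n)) (length>0 v∈)
  where
  length>0 : ∀ {v} {xs : List Point} → v ∈ xs → 0 ℕ.< length xs
  length>0 (here _)  = ℕ.z<s
  length>0 (there _) = ℕ.z<s
  search : ∀ f → 0 ℕ.< f → 0 ℕ.< distSearch n u w f 0
  search (suc f) _ with u == w in eq
  ... | true  = contradiction (==⇒≡ u w (from T-≡ eq)) u≢w
  ... | false = distSearch≥ n u w f 1

reach-step : ∀ {n k u v w} → v ∈ verts n → T (reach n k u v) → T (adj v w) → T (reach n (suc k) u w)
reach-step {n} {k} {u} {v} {w} v∈ uv vw =
  from (T-∨ {reach n k u w}) (inj₂ (any⁺ _ (lose v∈ (from (T-∧ {reach n k u v}) (uv , vw)))))

recip-suc-square : ∀ k → fromℕ (suc k) *ℚ recip (fromℕ (suc k ℕ.* suc k)) ≡ recip (fromℕ (suc k))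
recip-suc-square k = begin
  x *ℚ y                     ≡⟨ cong (_*ℚ y) (sym (*-identityˡ x)) ⟩
  1ℚ *ℚ x *ℚ y                ≡⟨ cong (λ t → t *ℚ x *ℚ y) (trans (sym (recip-inverse (0<fromℕ-suc k))) (*-comm x (recip x))) ⟩
  recip x *ℚ x *ℚ x *ℚ y       ≡⟨ cong (_*ℚ y) (*-assoc (recip x) x x) ⟩
  recip x *ℚ (x *ℚ x) *ℚ y     ≡⟨ *-assoc (recip x) (x *ℚ x) y ⟩
  recip x *ℚ (x *ℚ x *ℚ y)     ≡⟨ cong (λ t → recip x *ℚ (t *ℚ y)) (sym (fromℕ-* (suc k) (suc k))) ⟩
  recip x *ℚ (fromℕ (suc k ℕ.* suc k) *ℚ y) ≡⟨ cong (recip x *ℚ_) (recip-inverse (0<fromℕ-suc (k ℕ.+ k ℕ.* suc k))) ⟩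
  recip x *ℚ 1ℚ              ≡⟨ *-identityʳ (recip x) ⟩
  recip x                   ∎
  where
  open ≡-Reasoning
  x = fromℕ (suc k)
  y = recip (fromℕ (suc k ℕ.* suc k))

recip-fromℕ-antimono : ∀ {m n} → 0 ℕ.< m → m ℕ.≤ n → recip (fromℕ n) ≤ℚ recip (fromℕ m)
recip-fromℕ-antimono {suc m} _ m≤n = recip-antimono (0<fromℕ-suc m) (fromℕ-mono m≤n)

invSq-antimono : ∀ {d k} → 0 ℕ.< d → d ℕ.≤ k → recip (fromℕ (k ℕ.* k)) ≤ℚ invSq d
invSq-antimono {suc d} {k} _ d≤k = recip-fromℕ-antimono ℕ.z<s (ℕP.*-mono-≤ d≤k d≤k)

-- Harmonic sums and the binary logarithm

harmonic : ℕ → ℚ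
harmonic zero    = 0ℚ
harmonic (suc k) = recip (fromℕ (suc k)) + harmonic k

harmonic-mono : ∀ {j k} → j ℕ.≤ k → harmonic j ≤ℚ harmonic k
harmonic-mono {j} j≤k = go (ℕP.≤⇒≤′ j≤k)
  where
  go : ∀ {k} → j ℕ.≤′ k → harmonic j ≤ℚ harmonic k
  go ℕ.≤′-refl            = ≤-refl
  go (ℕ.≤′-step {k} j≤k) = ≤-trans (go j≤k) (p≤q+p (recip-nonneg (0≤fromℕ (suc k))))

harmonic-block : ∀ j i {k} → j ℕ.+ i ℕ.≤ k → harmonic j + fromℕ i *ℚ recip (fromℕ k) ≤ℚ harmonic (j ℕ.+ i)
harmonic-block j zero    {k} _ = ≤-reflexive (begin
  harmonic j + 0ℚ *ℚ recip (fromℕ k) ≡⟨ cong (harmonic j +_) (*-zeroˡ (recip (fromℕ k))) ⟩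
  harmonic j + 0ℚ                   ≡⟨ +-identityʳ (harmonic j) ⟩
  harmonic j                        ≡⟨ cong harmonic (sym (ℕP.+-identityʳ j)) ⟩
  harmonic (j ℕ.+ 0)                ∎)
  where open ≡-Reasoning
harmonic-block j (suc i) {k} h = begin
  harmonic j + fromℕ (suc i) *ℚ c      ≡⟨ cong (harmonic j +_) (trans (cong (_*ℚ c) (fromℕ-+ 1 i)) (*-distribʳ-+ c 1ℚ (fromℕ i))) ⟩
  harmonic j + (1ℚ *ℚ c + fromℕ i *ℚ c) ≡⟨ cong (λ t → harmonic j + (t + fromℕ i *ℚ c)) (*-identityˡ c) ⟩
  harmonic j + (c + fromℕ i *ℚ c)      ≡⟨ trans (sym (+-assoc (harmonic j) c (fromℕ i *ℚ c))) (trans (cong (_+ fromℕ i *ℚ c) (+-comm (harmonic j) c)) (+-assoc c (harmonic j) (fromℕ i *ℚ c))) ⟩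
  c + (harmonic j + fromℕ i *ℚ c)      ≤⟨ +-mono-≤ (recip-fromℕ-antimono ℕ.z<s h′) (harmonic-block j i (ℕP.<⇒≤ h′)) ⟩
  harmonic (suc (j ℕ.+ i))            ≡⟨ cong harmonic (sym (ℕP.+-suc j i)) ⟩
  harmonic (j ℕ.+ suc i)              ∎
  where
  open ≤-Reasoning
  c = recip (fromℕ k)
  h′ : suc (j ℕ.+ i) ℕ.≤ k
  h′ = subst (ℕ._≤ k) (ℕP.+-suc j i) h

2ℚ : ℚ
2ℚ = fromℕ 2

-- The dyadic block argument: doubling the range adds as many terms as it had, each at least the
-- reciprocal of the new end, hence at least one half. The summand 2 is twice the first term.
harmonic-2^ : ∀ t → fromℕ (2 ℕ.+ t) ≤ℚ 2ℚ *ℚ harmonic (2 ℕ.^ t)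
harmonic-2^ zero    = ≤-refl
harmonic-2^ (suc t) = begin
  fromℕ (1 ℕ.+ (2 ℕ.+ t))                  ≡⟨ trans (fromℕ-+ 1 (2 ℕ.+ t)) (+-comm 1ℚ (fromℕ (2 ℕ.+ t))) ⟩
  fromℕ (2 ℕ.+ t) + 1ℚ                     ≤⟨ +-monoˡ-≤ 1ℚ (harmonic-2^ t) ⟩
  2ℚ *ℚ harmonic p + 1ℚ                     ≡⟨ cong (2ℚ *ℚ harmonic p +_) (sym one) ⟩
  2ℚ *ℚ harmonic p + 2ℚ *ℚ (fromℕ p *ℚ recip (fromℕ (2 ℕ.* p)))
    ≡⟨ sym (*-distribˡ-+ 2ℚ (harmonic p) (fromℕ p *ℚ recip (fromℕ (2 ℕ.* p)))) ⟩
  2ℚ *ℚ (harmonic p + fromℕ p *ℚ recip (fromℕ (2 ℕ.* p)))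
    ≤⟨ *-monoˡ-≤-nonNeg 2ℚ (harmonic-block p p (ℕP.≤-reflexive (sym 2p))) ⟩
  2ℚ *ℚ harmonic (p ℕ.+ p)                  ≡⟨ cong (λ k → 2ℚ *ℚ harmonic k) (sym 2p) ⟩
  2ℚ *ℚ harmonic (2 ℕ.* p)                  ∎
  where
  open ≤-Reasoning
  p = 2 ℕ.^ t
  2p : 2 ℕ.* p ≡ p ℕ.+ p
  2p = cong (p ℕ.+_) (ℕP.+-identityʳ p)
  positive : ∀ {k} → 0 ℕ.< k → 0ℚ ℚ.< fromℕ k
  positive {suc k} _ = 0<fromℕ-suc k
  one : 2ℚ *ℚ (fromℕ p *ℚ recip (fromℕ (2 ℕ.* p))) ≡ 1ℚ
  one = trans (sym (*-assoc 2ℚ (fromℕ p) (recip (fromℕ (2 ℕ.* p)))))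
    (trans (cong (_*ℚ recip (fromℕ (2 ℕ.* p))) (sym (fromℕ-* 2 p)))
      (recip-inverse (positive (ℕP.m^n>0 2 (suc t)))))

between-powers : ∀ m → ∃ λ t → 2 ℕ.^ t ℕ.≤ suc m × suc m ℕ.≤ 2 ℕ.^ suc t
between-powers zero = 0 , ℕP.≤-refl , ℕ.s≤s ℕ.z≤n
between-powers (suc m) with t , lo , hi ← between-powers m with suc (suc m) ℕ.≤? 2 ℕ.^ suc t
... | yes hi′ = t , ℕP.m≤n⇒m≤1+n lo , hi′
... | no ¬hi′ = suc t , ℕP.<⇒≤ (ℕP.≰⇒> ¬hi′) ,
      ℕP.≤-trans (ℕP.+-mono-≤ (ℕP.m^n>0 2 (suc t)) hi)
        (ℕP.≤-reflexive (cong (2 ℕ.^ suc t ℕ.+_) (sym (ℕP.+-identityʳ (2 ℕ.^ suc t)))))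

-- If `m` lies between `2 ^ t` and `2 ^ suc t`, then `n ≤ 3m ≤ 2 ^ (3 + t)`. One factor 2 comes from
-- the dyadic bound, the other from `3 + t ≤ 2 (2 + t)`, which absorbs the loss of passing from `n`
-- to `m`.
log≤harmonic : ∀ {n} m → 0 ℕ.< n → n ℕ.≤ 3 ℕ.* m → fromℕ ⌊log₂ n ⌋ ≤ℚ 2ℚ *ℚ (2ℚ *ℚ harmonic m)
log≤harmonic {n} zero    0<n n≤3m = contradiction (ℕP.<-≤-trans 0<n n≤3m) λ ()
log≤harmonic {n} (suc m) _   n≤3m with t , lo , hi ← between-powers m = begin
  fromℕ ⌊log₂ n ⌋
    ≤⟨ fromℕ-mono (ℕP.≤-trans (⌊log₂⌋-mono-≤ n≤2^) (ℕP.≤-reflexive (⌊log₂[2^n]⌋≡n (3 ℕ.+ t)))) ⟩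
  fromℕ (3 ℕ.+ t)
    ≤⟨ fromℕ-mono (ℕP.+-mono-≤ (ℕP.n≤1+n 3) (ℕP.m≤m+n t (t ℕ.+ 0))) ⟩
  fromℕ (4 ℕ.+ 2 ℕ.* t)
    ≡⟨ trans (cong fromℕ (sym (ℕP.*-distribˡ-+ 2 2 t))) (fromℕ-* 2 (2 ℕ.+ t)) ⟩
  2ℚ *ℚ fromℕ (2 ℕ.+ t)
    ≤⟨ *-monoˡ-≤-nonNeg 2ℚ (harmonic-2^ t) ⟩
  2ℚ *ℚ (2ℚ *ℚ harmonic (2 ℕ.^ t))
    ≤⟨ *-monoˡ-≤-nonNeg 2ℚ (*-monoˡ-≤-nonNeg 2ℚ (harmonic-mono lo)) ⟩
  2ℚ *ℚ (2ℚ *ℚ harmonic (suc m)) ∎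
  where
  open ≤-Reasoning
  n≤2^ : n ℕ.≤ 2 ℕ.^ (3 ℕ.+ t)
  n≤2^ = ℕP.≤-trans n≤3m (ℕP.≤-trans (ℕP.*-mono-≤ (ℕP.n≤1+n 3) hi) (ℕP.≤-reflexive (ℕP.*-assoc 2 2 (2 ℕ.^ suc t))))

-- Walks that shift absolute value between coordinates

∣◃-◃suc∣≤1 : ∀ s m → ∣ (s ◃ m) ℤ.- (s ◃ suc m) ∣ ℕ.≤ 1
∣◃-◃suc∣≤1 Sign.+ zero    = ℕP.≤-refl
∣◃-◃suc∣≤1 Sign.+ (suc m) = ℕP.≤-reflexive (trans (cong ∣_∣ (ℤP.[1+m]⊖[1+n]≡m⊖n m (suc m)))
  (trans (ℤP.∣⊖∣-≤ (ℕP.n≤1+n m)) (ℕP.m+n∸n≡m 1 m)))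
∣◃-◃suc∣≤1 Sign.- zero    = ℕP.≤-refl
∣◃-◃suc∣≤1 Sign.- (suc m) = ℕP.≤-reflexive (trans (cong ∣_∣ (ℤP.[1+m]⊖[1+n]≡m⊖n (suc m) m))
  (trans (ℤP.∣m⊖n∣≡∣n⊖m∣ (suc m) m) (trans (ℤP.∣⊖∣-≤ (ℕP.n≤1+n m)) (ℕP.m+n∸n≡m 1 m))))

-- Keeping the sign and shifting the absolute value treats all octants alike; at 0 the sign is
-- positive.
away : ℤ → ℕ → ℤ
away a i = sign a ◃ (∣ a ∣ ℕ.+ i)

toward : ℤ → ℕ → ℤ
toward c k = sign c ◃ (∣ c ∣ ℕ.∸ k)

away-injective : ∀ a {i j} → away a i ≡ away a j → i ≡ j
away-injective a {i} {j} eq = ℕP.+-cancelˡ-≡ ∣ a ∣ i j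
  (trans (sym (ℤP.abs-◃ (sign a) _)) (trans (cong ∣_∣ eq) (ℤP.abs-◃ (sign a) _)))

away-zero : ∀ a → away a 0 ≡ a
away-zero a = trans (cong (sign a ◃_) (ℕP.+-identityʳ ∣ a ∣)) (ℤP.◃-inverse a)

∣x-x∣≤1 : ∀ x → ∣ x ℤ.- x ∣ ℕ.≤ 1
∣x-x∣≤1 x = subst (ℕ._≤ 1) (cong ∣_∣ (sym (ℤP.+-inverseʳ x))) ℕ.z≤n

away-close : ∀ a i → ∣ away a i ℤ.- away a (suc i) ∣ ℕ.≤ 1
away-close a i = subst (λ k → ∣ away a i ℤ.- (sign a ◃ k) ∣ ℕ.≤ 1) (sym (ℕP.+-suc ∣ a ∣ i))
  (∣◃-◃suc∣≤1 (sign a) (∣ a ∣ ℕ.+ i))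

toward-close : ∀ c {k} → suc k ℕ.≤ ∣ c ∣ → ∣ toward c k ℤ.- toward c (suc k) ∣ ℕ.≤ 1
toward-close c {k} k<c = subst (ℕ._≤ 1) (ℤP.∣i-j∣≡∣j-i∣ (toward c (suc k)) (toward c k))
  (subst (λ m → ∣ toward c (suc k) ℤ.- (sign c ◃ m) ∣ ℕ.≤ 1) (sym (ℕP.+-∸-assoc 1 k<c))
    (∣◃-◃suc∣≤1 (sign c) (∣ c ∣ ℕ.∸ suc k)))

-- k of the k + 1 pairs with sum k, for each 1 ≤ k ≤ m.
levels : ℕ → List (ℕ × ℕ)
levels zero    = []
levels (suc k) = map (λ i → i , suc k ℕ.∸ i) (upTo (suc k)) ++ levels k

level-sum : ∀ k {i j} → (i , j) ∈ map (λ i → i , suc k ℕ.∸ i) (upTo (suc k)) → i ℕ.+ j ≡ suc k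
level-sum k ij∈ with i , i∈ , refl ← ∈-map⁻ (λ i → i , suc k ℕ.∸ i) ij∈ =
  ℕP.m+[n∸m]≡n (ℕP.<⇒≤ (∈-upTo⁻ i∈))

levels-bounds : ∀ m {i j} → (i , j) ∈ levels m → 0 ℕ.< i ℕ.+ j × i ℕ.+ j ℕ.≤ m
levels-bounds (suc k) ij∈ with ∈-++⁻ (map (λ i → i , suc k ℕ.∸ i) (upTo (suc k))) ij∈
... | inj₁ ij∈ = subst (0 ℕ.<_) (sym (level-sum k ij∈)) ℕ.z<s , ℕP.≤-reflexive (level-sum k ij∈)
... | inj₂ ij∈ = let lo , hi = levels-bounds k ij∈ in lo , ℕP.m≤n⇒m≤1+n hi

levels-unique : ∀ m → Unique (levels m)
levels-unique zero    = []
levels-unique (suc k) = Unique.++⁺ (Unique.map⁺ (cong proj₁) (Unique.upTo⁺ (suc k))) (levels-unique k)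
  λ { {i , j} (∈level , ∈levels) →
      ℕP.<-irrefl refl (subst (ℕ._≤ k) (level-sum k ∈level) (proj₂ (levels-bounds k ∈levels))) }

-- The `k` pairs listed on level `k` contribute at least `1 / k²` each, hence `1 / k` together.
Σ-levels : ∀ m (g : ℕ × ℕ → ℚ) →
  (∀ {i j} → 0 ℕ.< i ℕ.+ j → i ℕ.+ j ℕ.≤ m → recip (fromℕ ((i ℕ.+ j) ℕ.* (i ℕ.+ j))) ≤ℚ g (i , j)) →
  harmonic m ≤ℚ Σℚ (levels m) g
Σ-levels zero    g _ = ≤-refl
Σ-levels (suc k) g h = begin
  recip (fromℕ (suc k)) + harmonic k
    ≤⟨ +-mono-≤ level (Σ-levels k g (λ lo hi → h lo (ℕP.m≤n⇒m≤1+n hi))) ⟩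
  Σℚ ps g + Σℚ (levels k) g
    ≡⟨ sym (Σ-++ ps (levels k) g) ⟩
  Σℚ (levels (suc k)) g ∎
  where
  open ≤-Reasoning
  ps = map (λ i → i , suc k ℕ.∸ i) (upTo (suc k))
  c = recip (fromℕ (suc k ℕ.* suc k))
  level : recip (fromℕ (suc k)) ≤ℚ Σℚ ps g
  level = begin
    recip (fromℕ (suc k))          ≡⟨ sym (recip-suc-square k) ⟩
    fromℕ (suc k) *ℚ c              ≡⟨ cong (λ l → fromℕ l *ℚ c) (sym (trans (length-map (λ i → i , suc k ℕ.∸ i) (upTo (suc k))) (length-upTo (suc k)))) ⟩
    fromℕ (length ps) *ℚ c          ≡⟨ sym (Σ-const ps c) ⟩
    Σℚ ps (λ _ → c)                ≤⟨ Σ-mono ps (λ {(i , j)} ij∈ → subst (λ s → recip (fromℕ (s ℕ.* s)) ≤ℚ g (i , j)) (level-sum k ij∈)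
                                        (h (subst (0 ℕ.<_) (sym (level-sum k ij∈)) ℕ.z<s) (ℕP.≤-reflexive (level-sum k ij∈)))) ⟩
    Σℚ ps g                        ∎

-- For coordinate permutations, so that the third coordinate can be taken as the large one. The walk
-- is built directly on the images under `σ`, so `dist` need not be shown invariant.
record Symmetry : Set where
  field
    σ         : Point → Point
    norm1-σ   : ∀ p → norm1 (σ p) ≡ norm1 p
    Close-σ   : ∀ {p q} → Close p q → Close (σ p) (σ q)
    injective : ∀ {p q} → σ p ≡ σ q → p ≡ q

-- The points obtained from σ (a , b , c) by moving i + j units of absolute value out of the third coordinate,
-- i of them into the first and j into the second.
module Wedge (S : Symmetry) (a b c : ℤ) where
  open Symmetry S

  private
    m n : ℕ
    m = ∣ c ∣
    n = norm1 (a , b , c)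
    u : Point
    u = σ (a , b , c)

  w : ℕ → ℕ → Point
  w i j = away a i , away b j , toward c (i ℕ.+ j)

  v : ℕ × ℕ → Point
  v (i , j) = σ (w i j)

  v-injective : ∀ {p q} → v p ≡ v q → p ≡ q
  v-injective {i , j} {i' , j'} eq =
    let eq′ = injective eq in
    cong₂ _,_ (away-injective a (cong proj₁ eq′)) (away-injective b (cong (proj₁ ∘ proj₂) eq′))

  v-zero : v (0 , 0) ≡ u
  v-zero = cong σ (cong₂ _,_ (away-zero a) (cong₂ _,_ (away-zero b) (ℤP.◃-inverse c)))

  norm1-u : norm1 u ≡ n
  norm1-u = norm1-σ (a , b , c)

  v∈verts : ∀ {i j} → i ℕ.+ j ℕ.≤ m → v (i , j) ∈ verts n
  v∈verts {i} {j} i+j≤m = ∈-verts (v (i , j)) (begin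
    norm1 (σ (w i j))
      ≡⟨ norm1-σ (w i j) ⟩
    ∣ away a i ∣ ℕ.+ ∣ away b j ∣ ℕ.+ ∣ toward c (i ℕ.+ j) ∣
      ≡⟨ cong₂ ℕ._+_ (cong₂ ℕ._+_ (ℤP.abs-◃ (sign a) (∣ a ∣ ℕ.+ i)) (ℤP.abs-◃ (sign b) (∣ b ∣ ℕ.+ j))) (ℤP.abs-◃ (sign c) (m ℕ.∸ (i ℕ.+ j))) ⟩
    (∣ a ∣ ℕ.+ i) ℕ.+ (∣ b ∣ ℕ.+ j) ℕ.+ (m ℕ.∸ (i ℕ.+ j))
      ≡⟨ cong (ℕ._+ (m ℕ.∸ (i ℕ.+ j))) (ℕ+.interchange (∣ a ∣) i (∣ b ∣) j) ⟩
    (∣ a ∣ ℕ.+ ∣ b ∣) ℕ.+ (i ℕ.+ j) ℕ.+ (m ℕ.∸ (i ℕ.+ j))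
      ≡⟨ ℕP.+-assoc (∣ a ∣ ℕ.+ ∣ b ∣) (i ℕ.+ j) _ ⟩
    (∣ a ∣ ℕ.+ ∣ b ∣) ℕ.+ ((i ℕ.+ j) ℕ.+ (m ℕ.∸ (i ℕ.+ j)))
      -- `i + j ≤ m` makes the truncated subtraction exact, so the norm is preserved.
      ≡⟨ cong ((∣ a ∣ ℕ.+ ∣ b ∣) ℕ.+_) (ℕP.m+[n∸m]≡n i+j≤m) ⟩
    n ∎)
    where open ≡-Reasoning

  adj-first : ∀ {i j} → suc i ℕ.+ j ℕ.≤ m → T (adj (v (i , j)) (v (suc i , j)))
  adj-first {i} {j} h = Close⇒adj (v (i , j)) (v (suc i , j))
    (λ eq → ℕP.m≢1+n+m i {0} (cong proj₁ (v-injective eq)))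
    (Close-σ (away-close a i , ∣x-x∣≤1 (away b j) , toward-close c h))

  adj-second : ∀ {i j} → suc (i ℕ.+ j) ℕ.≤ m → T (adj (v (i , j)) (v (i , suc j)))
  adj-second {i} {j} h = Close⇒adj (v (i , j)) (v (i , suc j))
    (λ eq → ℕP.m≢1+n+m j {0} (cong proj₂ (v-injective eq)))
    (Close-σ (∣x-x∣≤1 (away a i) , away-close b j ,
      subst (λ k → ∣ toward c (i ℕ.+ j) ℤ.- toward c k ∣ ℕ.≤ 1) (sym (ℕP.+-suc i j)) (toward-close c h)))

  -- The walk enlarges the second coordinate `j` times, then the first `i` times, each step paid for
  -- by the third.
  reach-v : ∀ i j → i ℕ.+ j ℕ.≤ m → T (reach n (i ℕ.+ j) u (v (i , j)))
  reach-v zero    zero    _ = subst (λ p → T (u == p)) (sym v-zero) (==-refl u)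
  reach-v zero    (suc j) h = reach-step {n} {j} (v∈verts (ℕP.<⇒≤ h)) (reach-v zero j (ℕP.<⇒≤ h)) (adj-second {0} {j} h)
  reach-v (suc i) j       h = reach-step {n} {i ℕ.+ j} (v∈verts (ℕP.<⇒≤ h)) (reach-v i j (ℕP.<⇒≤ h)) (adj-first {i} {j} h)

  u≢v : ∀ {i j} → 0 ℕ.< i ℕ.+ j → u ≢ v (i , j)
  u≢v {i} {j} 0<i+j eq with refl ← v-injective {0 , 0} {i , j} (trans v-zero eq) = ℕP.<-irrefl refl 0<i+j

  harmonic≤ : harmonic m ≤ℚ Σℚ (others n u) (λ p → invSq (dist n u p))
  harmonic≤ = begin
    harmonic m
      ≤⟨ Σ-levels m (λ p → invSq (dist n u (v p))) (λ {i} {j} 0<i+j i+j≤m →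
           invSq-antimono {dist n u (v (i , j))} {i ℕ.+ j} (dist>0 n (∈-verts u norm1-u) (u≢v {i} {j} 0<i+j)) (dist≤ n {k = i ℕ.+ j} (reach-v i j i+j≤m))) ⟩
    Σℚ (levels m) (λ p → invSq (dist n u (v p)))
      ≡⟨ sym (Σ-map (levels m) v (λ p → invSq (dist n u p))) ⟩
    Σℚ (map v (levels m)) (λ p → invSq (dist n u p))
      ≤⟨ Σ-⊆ (Unique.map⁺ v-injective (levels-unique m)) v⊆others (λ {p} _ → invSq-nonneg (dist n u p)) ⟩
    Σℚ (others n u) (λ p → invSq (dist n u p)) ∎
    where
    open ≤-Reasoning
    v⊆others : map v (levels m) ⊆ others n u
    v⊆others p∈ with (i , j) , ij∈ , refl ← ∈-map⁻ v p∈ =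
      let lo , hi = levels-bounds m ij∈ in
      ∈-filter⁺ (λ p → T? (not (u == p))) (v∈verts {i} {j} hi) (≢⇒not-== u (v (i , j)) (u≢v {i} {j} lo))

identity swap₂₃ swap₁₃ : Symmetry
identity = record { σ = id ; norm1-σ = λ _ → refl ; Close-σ = id ; injective = id }
swap₂₃ = record
  { σ         = λ { (a , b , c) → a , c , b }
  ; norm1-σ   = λ { (a , b , c) → ℕ+.xy∙z≈xz∙y (∣ a ∣) (∣ c ∣) (∣ b ∣) }
  ; Close-σ   = λ { (h₁ , h₂ , h₃) → h₁ , h₃ , h₂ }
  ; injective = λ { refl → refl }
  }
swap₁₃ = record
  { σ         = λ { (a , b , c) → c , b , a }
  ; norm1-σ   = λ { (a , b , c) → ℕ+.xy∙z≈zy∙x (∣ c ∣) (∣ b ∣) (∣ a ∣) }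
  ; Close-σ   = λ { (h₁ , h₂ , h₃) → h₃ , h₂ , h₁ }
  ; injective = λ { refl → refl }
  }

largest-third : ∀ a b c → let n = a ℕ.+ b ℕ.+ c in n ℕ.≤ 3 ℕ.* c ⊎ n ℕ.≤ 3 ℕ.* b ⊎ n ℕ.≤ 3 ℕ.* a
largest-third a b c with a ℕ.+ b ℕ.+ c ℕ.≤? 3 ℕ.* c | a ℕ.+ b ℕ.+ c ℕ.≤? 3 ℕ.* b | a ℕ.+ b ℕ.+ c ℕ.≤? 3 ℕ.* a
... | yes h | _     | _     = inj₁ h
... | no _  | yes h | _     = inj₂ (inj₁ h)
... | no _  | no _  | yes h = inj₂ (inj₂ h)
-- Adding the three strict inequalities gives `3n < 3n`.
... | no hc | no hb | no ha = contradiction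
        (ℕP.+-mono-< (ℕP.+-mono-< (ℕP.≰⇒> ha) (ℕP.≰⇒> hb)) (ℕP.≰⇒> hc))
        (ℕP.<-irrefl (sym thrice))
  where
  open ≡-Reasoning
  n = a ℕ.+ b ℕ.+ c
  thrice : n ℕ.+ n ℕ.+ n ≡ 3 ℕ.* a ℕ.+ 3 ℕ.* b ℕ.+ 3 ℕ.* c
  thrice = begin
    n ℕ.+ n ℕ.+ n                         ≡⟨ ℕP.+-assoc n n n ⟩
    n ℕ.+ (n ℕ.+ n)                       ≡⟨ cong (λ t → n ℕ.+ (n ℕ.+ t)) (sym (ℕP.+-identityʳ n)) ⟩
    3 ℕ.* n                               ≡⟨ ℕP.*-distribˡ-+ 3 (a ℕ.+ b) c ⟩
    3 ℕ.* (a ℕ.+ b) ℕ.+ 3 ℕ.* c           ≡⟨ cong (ℕ._+ 3 ℕ.* c) (ℕP.*-distribˡ-+ 3 a b) ⟩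
    3 ℕ.* a ℕ.+ 3 ℕ.* b ℕ.+ 3 ℕ.* c       ∎

-- Frees `n`, which inside `Wedge` is by definition the norm.
harmonic≤Σ-invSq : ∀ {n} S a b c → norm1 (a , b , c) ≡ n → let u = Symmetry.σ S (a , b , c) in
  harmonic ∣ c ∣ ≤ℚ Σℚ (others n u) (λ p → invSq (dist n u p))
harmonic≤Σ-invSq S a b c refl = Wedge.harmonic≤ S a b c

log≤Σ-invSq : ∀ {n} u → 0 ℕ.< n → norm1 u ≡ n →
  fromℕ ⌊log₂ n ⌋ ≤ℚ 2ℚ *ℚ (2ℚ *ℚ Σℚ (others n u) (λ p → invSq (dist n u p)))
log≤Σ-invSq {n} u@(a , b , c) 0<n ∣u∣≡n =
  by-cases (subst (λ k → k ℕ.≤ 3 ℕ.* ∣ c ∣ ⊎ k ℕ.≤ 3 ℕ.* ∣ b ∣ ⊎ k ℕ.≤ 3 ℕ.* ∣ a ∣) ∣u∣≡n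
             (largest-third (∣ a ∣) (∣ b ∣) (∣ c ∣)))
  where
  s : ℚ
  s = Σℚ (others n u) (λ p → invSq (dist n u p))
  via : ∀ m → n ℕ.≤ 3 ℕ.* m → harmonic m ≤ℚ s → fromℕ ⌊log₂ n ⌋ ≤ℚ 2ℚ *ℚ (2ℚ *ℚ s)
  via m n≤3m h = ≤-trans (log≤harmonic m 0<n n≤3m) (*-monoˡ-≤-nonNeg 2ℚ (*-monoˡ-≤-nonNeg 2ℚ h))
  by-cases : n ℕ.≤ 3 ℕ.* ∣ c ∣ ⊎ n ℕ.≤ 3 ℕ.* ∣ b ∣ ⊎ n ℕ.≤ 3 ℕ.* ∣ a ∣ → fromℕ ⌊log₂ n ⌋ ≤ℚ 2ℚ *ℚ (2ℚ *ℚ s)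
  by-cases (inj₁ h)        = via (∣ c ∣) h (harmonic≤Σ-invSq identity a b c ∣u∣≡n)
  -- The wedge starts from the permuted triple, which the transposition sends back to `u`.
  by-cases (inj₂ (inj₁ h)) = via (∣ b ∣) h (harmonic≤Σ-invSq swap₂₃ a c b (trans (Symmetry.norm1-σ swap₂₃ (a , b , c)) ∣u∣≡n))
  by-cases (inj₂ (inj₂ h)) = via (∣ a ∣) h (harmonic≤Σ-invSq swap₁₃ c b a (trans (Symmetry.norm1-σ swap₁₃ (a , b , c)) ∣u∣≡n))

-- The bound on a single choice and the conclusion

4ℚ : ℚ
4ℚ = 2ℚ *ℚ 2ℚ

Z*log≤4 : ∀ {n} u → 0 ℕ.< n → norm1 u ≡ n → Z n u *ℚ fromℕ ⌊log₂ n ⌋ ≤ℚ 4ℚ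
Z*log≤4 {n} u 0<n ∣u∣≡n = begin
  Z n u *ℚ fromℕ ⌊log₂ n ⌋   ≤⟨ *-monoˡ-≤-nonNeg (Z n u) {{ℚ.nonNegative (Z-nonneg n u)}} (log≤Σ-invSq u 0<n ∣u∣≡n) ⟩
  Z n u *ℚ (2ℚ *ℚ (2ℚ *ℚ s))   ≡⟨ cong (Z n u *ℚ_) (sym (*-assoc 2ℚ 2ℚ s)) ⟩
  Z n u *ℚ (4ℚ *ℚ s)          ≡⟨ trans (sym (*-assoc (Z n u) 4ℚ s)) (trans (cong (_*ℚ s) (*-comm (Z n u) 4ℚ)) (*-assoc 4ℚ (Z n u) s)) ⟩
  4ℚ *ℚ (Z n u *ℚ s)          ≤⟨ *-monoˡ-≤-nonNeg 4ℚ (recip*p≤1 s) ⟩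
  4ℚ *ℚ 1ℚ                   ≡⟨ *-identityʳ 4ℚ ⟩
  4ℚ                        ∎
  where
  open ≤-Reasoning
  s : ℚ
  s = Σℚ (others n u) (λ w → invSq (dist n u w))

invSq≤1 : ∀ d → invSq d ≤ℚ 1ℚ
invSq≤1 zero    = 0≤1
invSq≤1 (suc d) = recip-fromℕ-antimono {1} {suc d ℕ.* suc d} ℕ.z<s (ℕ.s≤s ℕ.z≤n)

choiceProb≤4/log : ∀ {n} → 0ℚ ℚ.< fromℕ ⌊log₂ n ⌋ → 0 ℕ.< n → ∀ {u} → u ∈ verts n → ∀ c →
                   choiceProb n u c ≤ℚ 4ℚ *ℚ recip (fromℕ ⌊log₂ n ⌋)
choiceProb≤4/log {n} 0<ℓ 0<n {u} u∈ c = begin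
  Z n u *ℚ invSq (dist n u c) ≤⟨ *-monoˡ-≤-nonNeg (Z n u) {{ℚ.nonNegative (Z-nonneg n u)}} (invSq≤1 (dist n u c)) ⟩
  Z n u *ℚ 1ℚ                 ≡⟨ cong (Z n u *ℚ_) (sym (recip-inverse 0<ℓ)) ⟩
  Z n u *ℚ (ℓ *ℚ recip ℓ)      ≡⟨ sym (*-assoc (Z n u) ℓ (recip ℓ)) ⟩
  Z n u *ℚ ℓ *ℚ recip ℓ        ≤⟨ *-monoʳ-≤-nonNeg (recip ℓ) {{ℚ.nonNegative (recip-nonneg (<⇒≤ 0<ℓ))}} (Z*log≤4 u 0<n ∣u∣≡n) ⟩
  4ℚ *ℚ recip ℓ               ∎
  where
  open ≤-Reasoning
  ℓ : ℚ
  ℓ = fromℕ ⌊log₂ n ⌋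
  ∣u∣≡n : norm1 u ≡ n
  ∣u∣≡n = proj₂ (∈-filter⁻ (λ p → norm1 p ℕ.≟ n) {xs = cube n} u∈)

PrE*log≤ : ∀ {n} u → 2 ℕ.≤ n → norm1 u ≡ n →
  PrE n u *ℚ fromℕ ⌊log₂ n ⌋ ≤ℚ 28ℚ *ℚ 28ℚ *ℚ 4ℚ + (28ℚ *ℚ 28ℚ *ℚ 4ℚ + 28ℚ *ℚ 28ℚ *ℚ 4ℚ)
PrE*log≤ {n} u 2≤n ∣u∣≡n = begin
  PrE n u *ℚ ℓ
    ≤⟨ *-monoʳ-≤-nonNeg ℓ {{ℚ.nonNegative (<⇒≤ 0<ℓ)}}
         (PrE≤ n (*-nonneg (nonNegative⁻¹ 4ℚ) (recip-nonneg (<⇒≤ 0<ℓ))) (choiceProb≤4/log 0<ℓ 0<n) (∈-verts u ∣u∣≡n)) ⟩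
  (D *ℚ ζ + (D *ℚ ζ + D *ℚ ζ)) *ℚ ℓ
    ≡⟨ trans (*-distribʳ-+ ℓ (D *ℚ ζ) (D *ℚ ζ + D *ℚ ζ)) (cong (D *ℚ ζ *ℚ ℓ +_) (*-distribʳ-+ ℓ (D *ℚ ζ) (D *ℚ ζ))) ⟩
  D *ℚ ζ *ℚ ℓ + (D *ℚ ζ *ℚ ℓ + D *ℚ ζ *ℚ ℓ)
    ≡⟨ cong (λ t → t + (t + t)) D*ζ*ℓ ⟩
  D *ℚ 4ℚ + (D *ℚ 4ℚ + D *ℚ 4ℚ) ∎
  where
  open ≤-Reasoning
  D ℓ ζ : ℚ
  D = 28ℚ *ℚ 28ℚ
  ℓ = fromℕ ⌊log₂ n ⌋
  ζ = 4ℚ *ℚ recip ℓ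
  0<n : 0 ℕ.< n
  0<n = ℕP.<-≤-trans ℕ.z<s 2≤n
  0<ℓ : 0ℚ ℚ.< ℓ
  -- For `n ≥ 2` the logarithm is at least 1 and can be inverted; hence the threshold 2.
  0<ℓ = <-≤-trans (positive⁻¹ 1ℚ) (fromℕ-mono (⌊log₂⌋-mono-≤ 2≤n))
  D*ζ*ℓ : D *ℚ ζ *ℚ ℓ ≡ D *ℚ 4ℚ
  D*ζ*ℓ = trans (*-assoc D ζ ℓ) (cong (D *ℚ_)
    (trans (*-assoc 4ℚ (recip ℓ) ℓ)
      (trans (cong (4ℚ *ℚ_) (trans (*-comm (recip ℓ) ℓ) (recip-inverse 0<ℓ))) (*-identityʳ 4ℚ))))

theorem3 : ∃[ C ] ∃[ N ] (∀ (n : ℕ) → N ≤ n → ∀ (u : Point) → norm1 u ≡ n →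
    (PrE n u *ℚ fromℕ ⌊log₂ n ⌋) ≤ℚ C)
-- Three kinds of triangle, a factor 28 for each of the two free vertices, and 4 from the
-- normaliser.
theorem3 = 28ℚ *ℚ 28ℚ *ℚ 4ℚ + (28ℚ *ℚ 28ℚ *ℚ 4ℚ + 28ℚ *ℚ 28ℚ *ℚ 4ℚ) , 2 , λ n 2≤n u ∣u∣≡n → PrE*log≤ u 2≤n ∣u∣≡n
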